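{- Let $H=(V,E,w)$ be a hypergraph with at least one hyperedge, and let $\gamma_1=\min\{D(f): f\in\mathbb{R}^n,\ \sum_v\deg(v)f(v)^2>0\}$, where $D(f)=\frac{\sum_{e\in E}w(e)\big(\max_{u\in e}f(u)+\min_{v\in e}f(v)\big)^2}{\sum_{v\in V}\deg(v)f(v)^2}$. Then there are disjoint sets $L,R\subset V$ with $\mathrm{vol}(L\cup R)>0$ such that $$\beta_H(L,R)\le\sqrt{2\gamma_1}.$$
   Context: A hypergraph $H=(V,E,w)$ has vertex set $V$ with $|V|=n$, hyperedges $E$ (subsets of $V$), weights $w:E\to\mathbb{R}_{>0}$; $\deg(v)=\sum_{e\ni v}w(e)$, $\mathrm{vol}(S)=\sum_{v\in S}\deg(v)$. For $A,B,C\subseteq V$, $w(A,B\mid C)=\sum_{e\in E}w(e)[e\cap A\ne\emptyset\wedge e\cap B\ne\emptyset\wedge e\cap C=\emptyset]$ and $w(A\mid C)=w(A,A\mid C)$. Writing $\overline{X}=V\setminus X$, the bipartiteness ratio of disjoint $L,R$ (with $\mathrm{vol}(L\cup R)>0$) is $\beta_H(L,R)=\frac{2w(L\mid\overline{L})+2w(R\mid\overline{R})+w(L,\overline{L\cup R}\mid R)+w(R,\overline{L\cup R}\mid L)}{\mathrm{vol}(L\cup R)}$. The quantity $\gamma_1$ is the minimum eigenvalue of the paper's hypergraph operator $D_H^{ -1}J_H$. -}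

module Defs where

open import Algebra.Bundles using (CommutativeRing; CommutativeSemiring)
open import Algebra.Definitions using (Invertible)
open import Algebra.Structures using (IsCommutativeRing)
import Algebra.Construct.NaturalChoice.Max as Max
import Algebra.Properties.Monoid.Sum as Sum
import Algebra.Properties.Ring as RingProperties
import Algebra.Solver.Ring.NaturalCoefficients.Default as Solver
open import Data.Bool using (if_then_else_)
open import Data.Fin using (Fin)
open import Data.Fin.Subset using (Subset; _∩_; _∪_; ∁; Nonempty)
open import Data.Fin.Subset.Properties using (_∈?_; nonempty?)
open import Data.List using (List; map; filter; allFin)
import Data.List.Extrema as Extrema
open import Data.Nat using (ℕ)
open import Data.Product using (Σ; ∃; ∃-syntax; _×_; _,_; proj₁; proj₂)
open import Data.Sum using (inj₁; inj₂)
open import Data.Vec.Functional using (Vector)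
open import Function.Definitions using (Injective)
open import Level using (Level; suc)
open import Relation.Binary.Bundles using (DecTotalOrder)
open import Relation.Binary.Core using (Rel)
import Relation.Binary.Properties.DecTotalOrder as OrderProperties
open import Relation.Binary.PropositionalEquality using (_≡_)
open import Relation.Binary.Structures using (IsDecTotalOrder)
import Relation.Binary.Reasoning.Setoid as SetoidReasoning
open import Relation.Nullary using (¬_; Dec; does; yes; no; ¬?; contradiction)
open import Relation.Nullary.Decidable using (_×-dec_)
open import Relation.Unary using (Pred)

-- The real numbers, given by their axioms: classically these determine ℝ up
-- to unique isomorphism.  The order is decidable and every inhabited bounded
-- predicate has a supremum, as for the classical reals.

record CompleteOrderedField (ℓ : Level) : Set (suc ℓ) where
  infix  8 -_
  infixl 7 _*_
  infixl 6 _+_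
  infix  4 _≈_ _≤_
  field
    Carrier           : Set ℓ
    _≈_               : Rel Carrier ℓ
    _≤_               : Rel Carrier ℓ
    _+_ _*_           : Carrier → Carrier → Carrier
    -_                : Carrier → Carrier
    0# 1#             : Carrier
    isCommutativeRing : IsCommutativeRing _≈_ _+_ _*_ -_ 0# 1#
    0≉1               : ¬ 0# ≈ 1#
    ≉0⇒invertible     : ∀ x → ¬ x ≈ 0# → Invertible _≈_ 1# _*_ x
    isDecTotalOrder   : IsDecTotalOrder _≈_ _≤_
    +-monoˡ-≤         : ∀ z {x y} → x ≤ y → x + z ≤ y + z
    *-nonNegative     : ∀ {x y} → 0# ≤ x → 0# ≤ y → 0# ≤ x * y

  IsUpperBound : Pred Carrier ℓ → Carrier → Set ℓ
  IsUpperBound P b = ∀ x → P x → x ≤ b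

  field
    supremum : (P : Pred Carrier ℓ) → ∃ P → ∃ (IsUpperBound P) →
               ∃[ s ] IsUpperBound P s × (∀ b → IsUpperBound P b → s ≤ b)

  commutativeRing : CommutativeRing ℓ ℓ
  commutativeRing = record { isCommutativeRing = isCommutativeRing }

  decTotalOrder : DecTotalOrder ℓ ℓ ℓ
  decTotalOrder = record { isDecTotalOrder = isDecTotalOrder }

  open DecTotalOrder decTotalOrder public
    using (totalOrder; _≤?_; total; antisym; ≤-respˡ-≈; ≤-respʳ-≈)
    renaming (refl to ≤-refl; reflexive to ≤-reflexive; trans to ≤-trans)
  open OrderProperties decTotalOrder public
    using (_<_; <-respʳ-≈; <-trans; <⇒≉; ≤∧≉⇒<; <⇒≱; ≰⇒>; ≮⇒≥)
  open CommutativeRing commutativeRing public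
    using ( setoid; ring; commutativeSemiring; +-monoid; refl; sym; trans
          ; +-cong; +-congˡ; +-congʳ; +-assoc; +-comm; +-identityˡ; +-identityʳ
          ; -‿inverseˡ; -‿inverseʳ; *-cong; *-congˡ; *-congʳ; *-assoc; *-comm; distribˡ; -‿cong
          ; *-identityˡ; *-identityʳ; zeroˡ; zeroʳ; _-_)
  open Sum +-monoid public using (sum; sum-syntax)
  open Max totalOrder public using (_⊔_; x≤y⊔x; x≤y⇒y⊔x≈y)

  2# : Carrier
  2# = 1# + 1#

  infixr 8 _²
  _² : Carrier → Carrier
  x ² = x * x

  infixl 7 _/_[_]
  _/_[_] : (x y : Carrier) → 0# < y → Carrier
  x / y [ 0<y ] = x * proj₁ (≉0⇒invertible y (λ y≈0 → <⇒≉ 0<y (sym y≈0)))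

  IsMinimum : Pred Carrier ℓ → Carrier → Set ℓ
  IsMinimum P m = P m × (∀ x → P x → m ≤ x)

module Identities {c ℓ} (R : CommutativeSemiring c ℓ) where
  open CommutativeSemiring R
  open Solver R using (solve; _:+_; _:*_; _:=_; con)

  square-1+ : ∀ a → a + (1# + a + a * a) ≈ (1# + a) * (1# + a)
  square-1+ = solve 1 (λ a →
    a :+ (con 1 :+ a :+ a :* a) := (con 1 :+ a) :* (con 1 :+ a)) refl

  square-+ : ∀ x y → x * x + y * (x + x) + y * y ≈ (x + y) * (x + y)
  square-+ = solve 2 (λ x y →
    x :* x :+ y :* (x :+ x) :+ y :* y := (x :+ y) :* (x :+ y)) refl

  square-+′ : ∀ x y → x * x + y * (x + x + y) ≈ (x + y) * (x + y)
  square-+′ = solve 2 (λ x y →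
    x :* x :+ y :* (x :+ x :+ y) := (x :+ y) :* (x :+ y)) refl

  square-+″ : ∀ x y → (x + y) * (x + y) ≈ x * (x + y + y) + y * y
  square-+″ = solve 2 (λ x y →
    (x :+ y) :* (x :+ y) := x :* (x :+ y :+ y) :+ y :* y) refl

  regroup₁ : ∀ s ε d →
    s * s + ε * (s + s) + ε * (1# + d) ≈ s * s + ε * (d + (s + s + 1#))
  regroup₁ = solve 3 (λ s ε d →
    s :* s :+ ε :* (s :+ s) :+ ε :* (con 1 :+ d)
      := s :* s :+ ε :* (d :+ (s :+ s :+ con 1))) refl

  regroup₂ : ∀ a s ε → s * ε + (a + s * ε) + ε ≈ a + ε * (s + s + 1#)
  regroup₂ = solve 3 (λ a s ε →
    s :* ε :+ (a :+ s :* ε) :+ ε := a :+ ε :* (s :+ s :+ con 1)) refl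

  regroup₃ : ∀ a ε t →
    ε * (ε + t + t) + (a + (ε + ε * ε)) ≈ a + ε * (ε + t + (ε + t) + 1#)
  regroup₃ = solve 3 (λ a ε t →
    ε :* (ε :+ t :+ t) :+ (a :+ (ε :+ ε :* ε))
      := a :+ ε :* (ε :+ t :+ (ε :+ t) :+ con 1)) refl

module SquareRoot {ℓ} (ℝ : CompleteOrderedField ℓ) where
  open CompleteOrderedField ℝ
  open RingProperties ring using (-‿distribˡ-*; -‿involutive; +-cancelˡ)
  open Identities commutativeSemiring

  private
    +-monoʳ-≤ : ∀ z {x y} → x ≤ y → z + x ≤ z + y
    +-monoʳ-≤ z x≤y =
      ≤-respˡ-≈ (+-comm _ z) (≤-respʳ-≈ (+-comm _ z) (+-monoˡ-≤ z x≤y))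

    +-nonNegative : ∀ {x y} → 0# ≤ x → 0# ≤ y → 0# ≤ x + y
    +-nonNegative {x} 0≤x 0≤y =
      ≤-trans 0≤x (≤-respˡ-≈ (+-identityʳ x) (+-monoʳ-≤ x 0≤y))

    x≤x+y : ∀ x {y} → 0# ≤ y → x ≤ x + y
    x≤x+y x 0≤y = ≤-respˡ-≈ (+-identityʳ x) (+-monoʳ-≤ x 0≤y)

    ≤-<-trans : ∀ {x y z} → x ≤ y → y < z → x < z
    ≤-<-trans x≤y y<z =
      ≤∧≉⇒< (≤-trans x≤y (proj₁ y<z)) (λ x≈z → <⇒≱ y<z (≤-respˡ-≈ x≈z x≤y))

    x<x+y : ∀ x {y} → 0# < y → x < x + y
    x<x+y x 0<y = x≤x+y x (proj₁ 0<y) ,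
      λ x≈x+y → proj₂ 0<y (+-cancelˡ x _ _ (trans (+-identityʳ x) x≈x+y))

    difference : ∀ x y → x + (y - x) ≈ y
    difference x y = trans (+-comm x _) (trans (+-assoc y (- x) x)
      (trans (+-congˡ (-‿inverseˡ x)) (+-identityʳ y)))

    difference-nonNegative : ∀ {x y} → x ≤ y → 0# ≤ y - x
    difference-nonNegative {x} x≤y = ≤-respˡ-≈ (-‿inverseʳ x) (+-monoˡ-≤ (- x) x≤y)

    difference-positive : ∀ {x y} → x < y → 0# < y - x
    difference-positive {x} {y} (x≤y , x≉y) = difference-nonNegative x≤y ,
      λ 0≈y-x → x≉y (trans (sym (+-identityʳ x)) (trans (+-congˡ 0≈y-x) (difference x y)))

    *-monoʳ-≤ : ∀ {x y z} → 0# ≤ z → x ≤ y → z * x ≤ z * y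
    *-monoʳ-≤ {x} {y} {z} 0≤z x≤y = ≤-respʳ-≈
      (trans (sym (distribˡ z x (y - x)))
             (*-congˡ (difference x y)))
      (x≤x+y (z * x) (*-nonNegative 0≤z (difference-nonNegative x≤y)))

    0≤1 : 0# ≤ 1#
    0≤1 with total 0# 1#
    ... | inj₁ 0≤1 = 0≤1
    ... | inj₂ 1≤0 = ≤-respʳ-≈
          (trans (sym (-‿distribˡ-* 1# (- 1#)))
            (trans (-‿cong (*-identityˡ (- 1#))) (-‿involutive 1#)))
          (*-nonNegative 0≤-1 0≤-1)
      where
      0≤-1 : 0# ≤ - 1#
      0≤-1 = ≤-respʳ-≈ (+-identityˡ (- 1#)) (difference-nonNegative 1≤0)

    +-positive : ∀ {x y} → 0# ≤ x → 0# < y → 0# < x + y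
    +-positive {x} 0≤x 0<y = ≤-<-trans 0≤x (x<x+y x 0<y)

    divide : ∀ {d k} → 0# < d → 0# < k → ∃[ ε ] 0# < ε × ε * k ≈ d
    divide {d} {k} 0<d 0<k = ε , (0≤ε , 0≉ε) , εk≈d
      where
      ε = d / k [ 0<k ]
      εk≈d : ε * k ≈ d
      εk≈d = trans (*-assoc d _ k) (trans (*-congˡ (proj₁ (proj₂
        (≉0⇒invertible k (λ k≈0 → <⇒≉ 0<k (sym k≈0)))))) (*-identityʳ d))
      0≉ε : ¬ 0# ≈ ε
      0≉ε 0≈ε = proj₂ 0<d (trans (sym (zeroˡ k)) (trans (*-congʳ 0≈ε) εk≈d))
      0≤ε : 0# ≤ ε
      0≤ε with total 0# ε
      ... | inj₁ 0≤ε = 0≤ε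
      ... | inj₂ ε≤0 = contradiction
            (≤-respˡ-≈ (trans (*-comm k ε) εk≈d)
              (≤-respʳ-≈ (zeroʳ k) (*-monoʳ-≤ (proj₁ 0<k) ε≤0)))
            (<⇒≱ 0<d)

    *-positive : ∀ {x y} → 0# < x → 0# < y → 0# < x * y
    *-positive {x} {y} 0<x 0<y = *-nonNegative (proj₁ 0<x) (proj₁ 0<y) , λ 0≈xy →
      proj₂ 0<y (begin
        0#            ≈⟨ zeroʳ x⁻¹ ⟨
        x⁻¹ * 0#      ≈⟨ *-congˡ 0≈xy ⟩
        x⁻¹ * (x * y) ≈⟨ *-assoc x⁻¹ x y ⟨
        x⁻¹ * x * y   ≈⟨ *-congʳ (proj₁ (proj₂ inv)) ⟩
        1# * y        ≈⟨ *-identityˡ y ⟩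
        y             ∎)
      where
      open SetoidReasoning setoid
      inv = ≉0⇒invertible x (λ x≈0 → <⇒≉ 0<x (sym x≈0))
      x⁻¹ = proj₁ inv

    ²-cancel-≤ : ∀ {x y} → 0# ≤ y → x ² ≤ y ² → x ≤ y
    ²-cancel-≤ {x} {y} 0≤y x²≤y² with x ≤? y
    ... | yes x≤y = x≤y
    ... | no  x≰y = contradiction x²≤y² (<⇒≱ y²<x²)
      where
      d = x - y
      0<d : 0# < d
      0<d = difference-positive (≰⇒> x≰y)
      y²<x² : y ² < x ²
      y²<x² = <-respʳ-≈
        (trans (square-+′ y d)
               (*-cong (difference y x) (difference y x)))
        (x<x+y (y ²) (*-positive 0<d (+-positive (+-nonNegative 0≤y 0≤y) 0<d)))

    increase′ : ∀ a s d ε → 0# ≤ s → 0# < d → s ² + d ≈ a →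
                0# < ε → ε * (d + (s + s + 1#)) ≈ d → (s + ε) ² ≤ a
    increase′ a s d ε 0≤s 0<d s²+d≈a 0<ε εk≈d =
      ≤-respˡ-≈ (square-+ s ε)
        (≤-respʳ-≈ bound≈a
          (+-monoʳ-≤ (s ² + ε * (s + s))
            (*-monoʳ-≤ (proj₁ 0<ε) (≤-trans ε≤1 (x≤x+y 1# (proj₁ 0<d))))))
      where
      d<k : d < d + (s + s + 1#)
      d<k = x<x+y d (+-positive (+-nonNegative 0≤s 0≤s) (0≤1 , 0≉1))
      ε≤1 : ε ≤ 1#
      ε≤1 with total ε 1#
      ... | inj₁ ε≤1 = ε≤1
      ... | inj₂ 1≤ε = contradiction
            (≤-respˡ-≈ (*-identityʳ _)
              (≤-respʳ-≈ (trans (*-comm _ ε) εk≈d)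
                (*-monoʳ-≤ (proj₁ (<-trans 0<d d<k)) 1≤ε)))
            (<⇒≱ d<k)
      bound≈a : s ² + ε * (s + s) + ε * (1# + d) ≈ a
      bound≈a = trans (regroup₁ s ε d) (trans (+-congˡ εk≈d) s²+d≈a)

    increase : ∀ {a s} → 0# ≤ s → s ² < a → ∃[ t ] s < t × t ² ≤ a
    increase {a} {s} 0≤s s²<a =
      let 0<d = difference-positive s²<a
          ε , 0<ε , εk≈d = divide 0<d (+-positive (proj₁ 0<d)
            (+-positive (+-nonNegative 0≤s 0≤s) (0≤1 , 0≉1)))
      in s + ε , x<x+y s 0<ε ,
         increase′ a s (a - s ²) ε 0≤s 0<d (difference (s ²) a) 0<ε εk≈d

    decrease′ : ∀ a s ε t → 0# ≤ a → 0# ≤ s → 0# < ε →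
                a + ε * (s + s + 1#) ≈ s ² → ε + t ≈ s → 0# ≤ t × a ≤ t ²
    decrease′ a s ε t 0≤a 0≤s 0<ε a+εk≈s² ε+t≈s =
      ≤-respʳ-≈ (+-cancelˡ ε _ _ (trans (difference ε s) (sym ε+t≈s)))
        (difference-nonNegative ε≤s) ,
      ≤-respʳ-≈ a+ε+ε²≈t² (x≤x+y a
        (+-nonNegative (proj₁ 0<ε) (*-nonNegative (proj₁ 0<ε) (proj₁ 0<ε))))
      where
      open SetoidReasoning setoid
      ε≤s : ε ≤ s
      ε≤s with total ε s
      ... | inj₁ ε≤s = ε≤s
      ... | inj₂ s≤ε = contradiction
            (≤-trans (*-monoʳ-≤ 0≤s s≤ε) (x≤x+y (s * ε)
              (+-nonNegative 0≤a (*-nonNegative 0≤s (proj₁ 0<ε)))))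
            (<⇒≱ (<-respʳ-≈ (trans (regroup₂ a s ε) a+εk≈s²) (x<x+y _ 0<ε)))
      a+ε+ε²≈t² : a + (ε + ε ²) ≈ t ²
      a+ε+ε²≈t² = +-cancelˡ (ε * (ε + t + t)) _ _ (begin
        ε * (ε + t + t) + (a + (ε + ε ²))
          ≈⟨ regroup₃ a ε t ⟩
        a + ε * (ε + t + (ε + t) + 1#)
          ≈⟨ +-congˡ (*-congˡ (+-congʳ (+-cong ε+t≈s ε+t≈s))) ⟩
        a + ε * (s + s + 1#)
          ≈⟨ a+εk≈s² ⟩
        s ²
          ≈⟨ *-cong ε+t≈s ε+t≈s ⟨
        (ε + t) ²
          ≈⟨ square-+″ ε t ⟩
        ε * (ε + t + t) + t ² ∎)

    decrease : ∀ {a s} → 0# ≤ a → 0# ≤ s → a < s ² →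
               ∃[ t ] t < s × 0# ≤ t × a ≤ t ²
    decrease {a} {s} 0≤a 0≤s a<s² =
      let ε , 0<ε , εk≈d = divide (difference-positive a<s²)
            (+-positive (+-nonNegative 0≤s 0≤s) (0≤1 , 0≉1))
          ε+t≈s = difference ε s
      in s - ε ,
         <-respʳ-≈ (trans (+-comm (s - ε) ε) ε+t≈s) (x<x+y (s - ε) 0<ε) ,
         decrease′ a s ε (s - ε) 0≤a 0≤s 0<ε
           (trans (+-congˡ εk≈d) (difference a (s ²))) ε+t≈s

  √-exists : ∀ a → 0# ≤ a → ∃[ s ] 0# ≤ s × s ² ≈ a
  √-exists a 0≤a =
    let s , s-upper , s-least = supremum S (0# , 0∈S) (1# + a , bounded)
        0≤s = s-upper 0# 0∈S
    in s , 0≤s , antisym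
         (≮⇒≥ λ a<s² → let t , t<s , 0≤t , a≤t² = decrease 0≤a 0≤s a<s² in
           <⇒≱ t<s (s-least t λ y y²≤a → ²-cancel-≤ 0≤t (≤-trans y²≤a a≤t²)))
         (≮⇒≥ λ s²<a → let t , s<t , t²≤a = increase 0≤s s²<a in
           <⇒≱ s<t (s-upper t t²≤a))
    where
    S : Pred Carrier ℓ
    S y = y ² ≤ a
    0∈S : S 0#
    0∈S = ≤-respˡ-≈ (sym (zeroˡ 0#)) 0≤a
    bounded : IsUpperBound S (1# + a)
    bounded y y²≤a = ²-cancel-≤ (+-nonNegative 0≤1 0≤a) (≤-trans y²≤a
      (≤-respʳ-≈ (square-1+ a)
        (x≤x+y a (+-nonNegative (+-nonNegative 0≤1 0≤a) (*-nonNegative 0≤a 0≤a)))))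

  -- Total: negative arguments are sent to √ 0.
  infixr 9 √_
  √_ : Carrier → Carrier
  √ x = proj₁ (√-exists (x ⊔ 0#) (x≤y⊔x x 0#))

  0≤√ : ∀ x → 0# ≤ √ x
  0≤√ x = proj₁ (proj₂ (√-exists (x ⊔ 0#) (x≤y⊔x x 0#)))

  √-square : ∀ {x} → 0# ≤ x → (√ x) ² ≈ x
  √-square {x} 0≤x =
    trans (proj₂ (proj₂ (√-exists (x ⊔ 0#) (x≤y⊔x x 0#)))) (x≤y⇒y⊔x≈y 0≤x)

module HypergraphTheory {ℓ} (ℝ : CompleteOrderedField ℓ) where
  open CompleteOrderedField ℝ
  open SquareRoot ℝ public using (√_)

  -- A hypergraph on the vertex set Fin n.  Hyperedges are nonempty, so that
  -- maxima and minima over them exist, and form a set (no repetitions);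
  -- singletons are allowed.
  record Hypergraph (n : ℕ) : Set ℓ where
    field
      ∣E∣            : ℕ
      edge           : Fin ∣E∣ → Subset n
      edge-injective : Injective _≡_ _≡_ edge
      edge-nonempty  : ∀ e → Nonempty (edge e)
      w              : Fin ∣E∣ → Carrier
      w-positive     : ∀ e → 0# < w e

  𝟙 : ∀ {p} {P : Set p} → Dec P → Carrier
  𝟙 P? = if does P? then 1# else 0#

  elements : ∀ {n} → Subset n → List (Fin n)
  elements {n} S = filter (_∈? S) (allFin n)

  -- The extrema of the library take a default value, here f at some element of S.
  maxOver minOver : ∀ {n} → Vector Carrier n → (S : Subset n) → Nonempty S → Carrier
  maxOver f S (v , _) = Extrema.max totalOrder (f v) (map f (elements S))
  minOver f S (v , _) = Extrema.min totalOrder (f v) (map f (elements S))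

  module _ {n : ℕ} (H : Hypergraph n) where
    open Hypergraph H

    deg : Fin n → Carrier
    deg v = ∑[ e < ∣E∣ ] (w e * 𝟙 (v ∈? edge e))

    vol : Subset n → Carrier
    vol S = ∑[ v < n ] (deg v * 𝟙 (v ∈? S))

    -- cut A B C and cut₁ A C are w(A,B∣C) and w(A∣C).
    cut : (A B C : Subset n) → Carrier
    cut A B C = ∑[ e < ∣E∣ ] (w e *
      𝟙 (nonempty? (edge e ∩ A) ×-dec nonempty? (edge e ∩ B) ×-dec ¬? (nonempty? (edge e ∩ C))))

    cut₁ : (A C : Subset n) → Carrier
    cut₁ A C = cut A A C

    β : (L R : Subset n) → 0# < vol (L ∪ R) → Carrier
    β L R 0<vol =
      (2# * cut₁ L (∁ L) + 2# * cut₁ R (∁ R) + cut L (∁ (L ∪ R)) R + cut R (∁ (L ∪ R)) L)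
        / vol (L ∪ R) [ 0<vol ]

    ∥_∥²-deg : Vector Carrier n → Carrier
    ∥ f ∥²-deg = ∑[ v < n ] (deg v * f v ²)

    D : (f : Vector Carrier n) → 0# < ∥ f ∥²-deg → Carrier
    D f 0<∥f∥² =
      (∑[ e < ∣E∣ ] (w e * (maxOver f (edge e) (edge-nonempty e)
                          + minOver f (edge e) (edge-nonempty e)) ²))
        / ∥ f ∥²-deg [ 0<∥f∥² ]

    IsValueOfD : Pred Carrier ℓ
    IsValueOfD x = ∃[ f ] Σ (0# < ∥ f ∥²-deg) λ 0<∥f∥² → x ≈ D f 0<∥f∥²

{-# OPTIONS --safe #-}
module Submission where

open import Defs
open import Algebra.Bundles using (CommutativeRing)
import Algebra.Construct.NaturalChoice.Max as Max
import Algebra.Properties.Semiring.Sum as SemiringSum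
import Algebra.Solver.Ring.NaturalCoefficients.Default as Solver
open import Data.Bool using (true)
open import Data.Empty using (⊥; ⊥-elim)
open import Data.Fin using (Fin; zero; suc)
open import Data.Fin.Properties using (any?; _≟_)
open import Data.Fin.Subset using (Subset; _∩_; _∪_; ∁; _∈_; Nonempty; Empty)
open import Data.Fin.Subset.Properties
  using (_∈?_; nonempty?; ∪-comm; x∈p∩q⁺; x∈p∩q⁻; x∈p∪q⁺; x∈p∪q⁻; x∈∁p⇒x∉p; x∉p⇒x∈∁p)
open import Data.List using (List; []; _∷_; _++_; map; allFin)
import Data.List.Extrema as Extrema
open import Data.List.Membership.Propositional using () renaming (_∈_ to _∈ˡ_)
open import Data.List.Membership.Propositional.Properties
  using (∈-filter⁺; ∈-filter⁻; ∈-map⁺; ∈-map⁻; ∈-allFin; ∈-++⁺ˡ; ∈-++⁺ʳ)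
open import Data.List.Relation.Binary.Permutation.Propositional using (↭-sym)
open import Data.List.Relation.Binary.Permutation.Propositional.Properties
  using (∈-resp-↭; All-resp-↭)
open import Data.List.Relation.Unary.All as All using (All; []; _∷_)
import Data.List.Relation.Unary.All.Properties as AllP
open import Data.List.Relation.Unary.Any using (here; there)
open import Data.List.Relation.Unary.Linked using ([-]; _∷_)
open import Data.List.Relation.Unary.Linked.Properties using (Linked⇒All)
import Data.List.Relation.Unary.Sorted.TotalOrder as SortedList
import Data.List.Sort as Sort
open import Data.Nat using (ℕ; zero; suc) renaming (_<_ to _<ᴺ_)
open import Data.Product using (Σ; ∃-syntax; _×_; _,_; proj₁; proj₂)
open import Data.Sum using (_⊎_; inj₁; inj₂; [_,_]′)
import Data.Vec as Vec
open import Data.Vec.Properties using (lookup∘tabulate; lookup⇒[]=; []=⇒lookup)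
open import Data.Vec.Functional as V using (Vector)
open import Function using (_∘_; id)
open import Relation.Binary.Bundles using (DecTotalOrder; StrictTotalOrder)
import Relation.Binary.Properties.DecTotalOrder as OrderProperties
open import Relation.Binary.PropositionalEquality as ≡ using (_≡_; _≢_)
import Relation.Binary.Reasoning.PartialOrder as PartialOrderReasoning
open import Relation.Nullary using (¬_; Dec; does; yes; no; ¬?; contradiction)
open import Relation.Nullary.Decidable using (_×-dec_; dec-true)

-- Trevisan's threshold rounding.  Take f with D(f) = γ₁ and put q(x) = max(x, 0)².
-- For t > 0 let L = {v : t ≤ q(f v)} and R = {v : t ≤ q(- f v)}.  Integrated over t,
-- vol(L ∪ R) gives ∑ deg(v) f(v)².  If a and b are the maximum and minimum of f on an
-- edge e with a + b ≥ 0, then at every t the contribution of e to the numerator of β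
-- plus [t ≤ q(- b)] is at most [t ≤ q(a)] + [t ≤ q(b)], so its integral is at most
-- q(a) + q(b) - q(- b) ≤ (a + b) c with c² ≤ 2 ∑_{v ∈ e} f(v)²; the case a + b ≤ 0
-- follows by exchanging f with - f.  By Cauchy–Schwarz the integral of the numerator is
-- at most √(2γ₁) times that of the volume, and some t does as well as the average.
-- As only finitely many levels matter, a finite sum replaces the integral.

-- Ordered-field arithmetic and inequalities between finite sums.

module OrderedField {ℓ} (ℝ : CompleteOrderedField ℓ) where
  open CompleteOrderedField ℝ
  open SemiringSum (CommutativeRing.semiring commutativeRing)
    using (sum-cong-≋; sum-replicate-zero)
  open Solver commutativeSemiring using (solve; _:+_; _:*_; _:=_; con)
  open DecTotalOrder decTotalOrder using (poset)
  open PartialOrderReasoning poset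

  0≤difference : ∀ {x y} → x ≤ y → 0# ≤ y - x
  0≤difference {x} {y} x≤y = begin
    0#    ≈⟨ -‿inverseʳ x ⟨
    x - x ≤⟨ +-monoˡ-≤ (- x) x≤y ⟩
    y - x ∎

  difference : ∀ x y → x + (y - x) ≈ y
  difference x y = begin-equality
    x + (y - x)   ≈⟨ +-comm x _ ⟩
    y - x + x     ≈⟨ +-assoc y (- x) x ⟩
    y + (- x + x) ≈⟨ +-congˡ (-‿inverseˡ x) ⟩
    y + 0#        ≈⟨ +-identityʳ y ⟩
    y             ∎

  +-monoʳ-≤ : ∀ z {x y} → x ≤ y → z + x ≤ z + y
  +-monoʳ-≤ z {x} {y} x≤y = begin
    z + x ≈⟨ +-comm z x ⟩
    x + z ≤⟨ +-monoˡ-≤ z x≤y ⟩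
    y + z ≈⟨ +-comm y z ⟩
    z + y ∎

  +-mono-≤ : ∀ {x y u v} → x ≤ y → u ≤ v → x + u ≤ y + v
  +-mono-≤ {y = y} {u} x≤y u≤v = ≤-trans (+-monoˡ-≤ u x≤y) (+-monoʳ-≤ y u≤v)

  +-cancelʳ-≤ : ∀ z {x y} → x + z ≤ y + z → x ≤ y
  +-cancelʳ-≤ z {x} {y} x+z≤y+z = begin
    x             ≈⟨ cancel x ⟨
    x + z + (- z) ≤⟨ +-monoˡ-≤ (- z) x+z≤y+z ⟩
    y + z + (- z) ≈⟨ cancel y ⟩
    y             ∎
    where
    cancel : ∀ t → t + z + (- z) ≈ t
    cancel t = trans (+-assoc t z (- z)) (trans (+-congˡ (-‿inverseʳ z)) (+-identityʳ t))

  +-nonNegative : ∀ {x y} → 0# ≤ x → 0# ≤ y → 0# ≤ x + y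
  +-nonNegative 0≤x 0≤y = ≤-respˡ-≈ (+-identityʳ 0#) (+-mono-≤ 0≤x 0≤y)

  x≤x+y : ∀ x {y} → 0# ≤ y → x ≤ x + y
  x≤x+y x 0≤y = ≤-respˡ-≈ (+-identityʳ x) (+-monoʳ-≤ x 0≤y)

  x≤y+x : ∀ x {y} → 0# ≤ y → x ≤ y + x
  x≤y+x x 0≤y = ≤-respˡ-≈ (+-identityˡ x) (+-monoˡ-≤ x 0≤y)

  *-monoʳ-≤ : ∀ {x y z} → 0# ≤ z → x ≤ y → z * x ≤ z * y
  *-monoʳ-≤ {x} {y} {z} 0≤z x≤y = begin
    z * x               ≤⟨ x≤x+y (z * x) (*-nonNegative 0≤z (0≤difference x≤y)) ⟩
    z * x + z * (y - x) ≈⟨ distribˡ z x (y - x) ⟨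
    z * (x + (y - x))   ≈⟨ *-congˡ (difference x y) ⟩
    z * y               ∎

  *-monoˡ-≤ : ∀ {x y z} → 0# ≤ z → x ≤ y → x * z ≤ y * z
  *-monoˡ-≤ {x} {y} {z} 0≤z x≤y = begin
    x * z ≈⟨ *-comm x z ⟩
    z * x ≤⟨ *-monoʳ-≤ 0≤z x≤y ⟩
    z * y ≈⟨ *-comm z y ⟩
    y * z ∎

  *-mono-≤ : ∀ {x y u v} → 0# ≤ y → 0# ≤ u → x ≤ y → u ≤ v → x * u ≤ y * v
  *-mono-≤ 0≤y 0≤u x≤y u≤v = ≤-trans (*-monoˡ-≤ 0≤u x≤y) (*-monoʳ-≤ 0≤y u≤v)

  -- Stated for a pair with sum zero, so that only a semiring identity is needed:
  -- `x ² + y * (x + y)` equals `x * (x + y) + y ²`, and both mixed terms vanish.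
  x+y≈0⇒x²≈y² : ∀ {x y} → x + y ≈ 0# → x ² ≈ y ²
  x+y≈0⇒x²≈y² {x} {y} x+y≈0 = begin-equality
    x * x               ≈⟨ +-identityʳ _ ⟨
    x * x + 0#          ≈⟨ +-congˡ (zeroʳ y) ⟨
    x * x + y * 0#      ≈⟨ +-congˡ (*-congˡ x+y≈0) ⟨
    x * x + y * (x + y) ≈⟨ solve 2 (λ x y → x :* x :+ y :* (x :+ y)
                             := x :* (x :+ y) :+ y :* y) refl x y ⟩
    x * (x + y) + y * y ≈⟨ +-congʳ (*-congˡ x+y≈0) ⟩
    x * 0# + y * y      ≈⟨ +-congʳ (zeroʳ x) ⟩
    0# + y * y          ≈⟨ +-identityˡ _ ⟩
    y * y               ∎

  x+y≈0∧x≤0⇒0≤y : ∀ {x y} → x + y ≈ 0# → x ≤ 0# → 0# ≤ y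
  x+y≈0∧x≤0⇒0≤y {x} {y} x+y≈0 x≤0 = begin
    0#     ≈⟨ x+y≈0 ⟨
    x + y  ≤⟨ +-monoˡ-≤ y x≤0 ⟩
    0# + y ≈⟨ +-identityˡ y ⟩
    y      ∎

  x+y≈0∧0≤x⇒y≤0 : ∀ {x y} → x + y ≈ 0# → 0# ≤ x → y ≤ 0#
  x+y≈0∧0≤x⇒y≤0 {x} {y} x+y≈0 0≤x = begin
    y      ≤⟨ x≤y+x y 0≤x ⟩
    x + y  ≈⟨ x+y≈0 ⟩
    0#     ∎

  0≤x² : ∀ x → 0# ≤ x ²
  0≤x² x with total 0# x
  ... | inj₁ 0≤x = *-nonNegative 0≤x 0≤x
  ... | inj₂ x≤0 = ≤-respʳ-≈ (sym (x+y≈0⇒x²≈y² (-‿inverseʳ x)))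
    (*-nonNegative 0≤-x 0≤-x)
    where
    0≤-x : 0# ≤ - x
    0≤-x = x+y≈0∧x≤0⇒0≤y (-‿inverseʳ x) x≤0

  0≤1 : 0# ≤ 1#
  0≤1 = ≤-respʳ-≈ (*-identityˡ 1#) (0≤x² 1#)

  0≤2 : 0# ≤ 2#
  0≤2 = +-nonNegative 0≤1 0≤1

  /-cancel : ∀ x {y} (0<y : 0# < y) → x / y [ 0<y ] * y ≈ x
  /-cancel x {y} 0<y = trans (*-assoc x _ y) (trans (*-congˡ (proj₁ (proj₂
    (≉0⇒invertible y λ y≈0 → <⇒≉ 0<y (sym y≈0))))) (*-identityʳ x))

  *-cancelʳ-≤ : ∀ {x y z} → 0# < z → x * z ≤ y * z → x ≤ y
  *-cancelʳ-≤ {x} {y} {z} 0<z xz≤yz = begin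
    x             ≈⟨ cancel x ⟨
    x * z * z⁻¹   ≤⟨ *-monoˡ-≤ 0≤z⁻¹ xz≤yz ⟩
    y * z * z⁻¹   ≈⟨ cancel y ⟩
    y             ∎
    where
    z⁻¹ = 1# / z [ 0<z ]
    cancel : ∀ t → t * z * z⁻¹ ≈ t
    cancel t = trans (*-assoc t z z⁻¹) (trans (*-congˡ
      (trans (*-comm z z⁻¹) (/-cancel 1# 0<z))) (*-identityʳ t))
    0≤z⁻¹ : 0# ≤ z⁻¹
    0≤z⁻¹ with total 0# z⁻¹
    ... | inj₁ 0≤z⁻¹ = 0≤z⁻¹
    ... | inj₂ z⁻¹≤0 = ⊥-elim (0≉1 (antisym 0≤1 (begin
      1#      ≈⟨ /-cancel 1# 0<z ⟨
      z⁻¹ * z ≤⟨ *-monoˡ-≤ (proj₁ 0<z) z⁻¹≤0 ⟩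
      0# * z  ≈⟨ zeroˡ z ⟩
      0#      ∎)))

  /-≤ : ∀ {x y z} (0<y : 0# < y) → x ≤ z * y → x / y [ 0<y ] ≤ z
  /-≤ 0<y x≤zy = *-cancelʳ-≤ 0<y (≤-respˡ-≈ (sym (/-cancel _ 0<y)) x≤zy)

  ≤-<-trans : ∀ {x y z} → x ≤ y → y < z → x < z
  ≤-<-trans x≤y y<z =
    ≤∧≉⇒< (≤-trans x≤y (proj₁ y<z)) λ x≈z → <⇒≱ y<z (≤-respˡ-≈ x≈z x≤y)

  <-≤-trans : ∀ {x y z} → x < y → y ≤ z → x < z
  <-≤-trans x<y y≤z =
    ≤∧≉⇒< (≤-trans (proj₁ x<y) y≤z) λ x≈z → <⇒≱ x<y (≤-respʳ-≈ (sym x≈z) y≤z)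

  ²-mono-≤ : ∀ {x y} → 0# ≤ x → x ≤ y → x ² ≤ y ²
  ²-mono-≤ 0≤x x≤y = *-mono-≤ (≤-trans 0≤x x≤y) 0≤x x≤y x≤y

  ²-cancel-≤ : ∀ {x y} → 0# ≤ y → x ² ≤ y ² → x ≤ y
  ²-cancel-≤ {x} {y} 0≤y x²≤y² with x ≤? y
  ... | yes x≤y = x≤y
  ... | no  x≰y = *-cancelʳ-≤ (≤-<-trans 0≤y y<x)
          (≤-trans x²≤y² (*-monoʳ-≤ 0≤y (proj₁ y<x)))
    where
    y<x : y < x
    y<x = ≰⇒> x≰y

  0≤x+x⇒0≤x : ∀ {x} → 0# ≤ x + x → 0# ≤ x
  0≤x+x⇒0≤x {x} 0≤x+x with total 0# x
  ... | inj₁ 0≤x = 0≤x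
  ... | inj₂ x≤0 = ≤-trans 0≤x+x (≤-respʳ-≈ (+-identityʳ x) (+-monoʳ-≤ x x≤0))

  sum-mono-≤ : ∀ {n} {f g : Vector Carrier n} → (∀ i → f i ≤ g i) → sum f ≤ sum g
  sum-mono-≤ {zero}  f≤g = ≤-refl
  sum-mono-≤ {suc n} f≤g = +-mono-≤ (f≤g zero) (sum-mono-≤ (f≤g ∘ suc))

  sum-nonNegative : ∀ {n} {f : Vector Carrier n} → (∀ i → 0# ≤ f i) → 0# ≤ sum f
  sum-nonNegative {zero}  0≤f = ≤-refl
  sum-nonNegative {suc n} 0≤f = +-nonNegative (0≤f zero) (sum-nonNegative (0≤f ∘ suc))

  sum-zero : ∀ {n} {f : Vector Carrier n} → (∀ i → f i ≈ 0#) → sum f ≈ 0#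
  sum-zero {n} f≈0 = trans (sum-cong-≋ f≈0) (sum-replicate-zero n)

  term≤sum : ∀ {n} {f : Vector Carrier n} → (∀ i → 0# ≤ f i) → ∀ i → f i ≤ sum f
  term≤sum 0≤f zero    = x≤x+y _ (sum-nonNegative (0≤f ∘ suc))
  term≤sum 0≤f (suc i) = ≤-trans (term≤sum (0≤f ∘ suc) i) (x≤y+x _ (0≤f zero))

  terms≤sum : ∀ {n} {f : Vector Carrier n} → (∀ i → 0# ≤ f i) →
              ∀ {i j} → i ≢ j → f i + f j ≤ sum f
  terms≤sum 0≤f {zero}  {zero}  i≢j = contradiction ≡.refl i≢j
  terms≤sum 0≤f {zero}  {suc j} i≢j = +-monoʳ-≤ _ (term≤sum (0≤f ∘ suc) j)
  terms≤sum 0≤f {suc i} {zero}  i≢j =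
    ≤-respˡ-≈ (+-comm _ _) (+-monoʳ-≤ _ (term≤sum (0≤f ∘ suc) i))
  terms≤sum 0≤f {suc i} {suc j} i≢j =
    ≤-trans (terms≤sum (0≤f ∘ suc) (i≢j ∘ ≡.cong suc)) (x≤y+x _ (0≤f zero))

  -- The weighted Cauchy-Schwarz inequality.

  -- With `y` written as `x + d`, the two sides differ by exactly `d ²`.
  4xy≤[x+y]² : ∀ x y → 2# ² * (x * y) ≤ (x + y) ²
  4xy≤[x+y]² x y = begin
    2# ² * (x * y)             ≈⟨ *-congˡ (*-congˡ x+d≈y) ⟨
    2# ² * (x * (x + d))       ≤⟨ x≤x+y _ (0≤x² d) ⟩
    2# ² * (x * (x + d)) + d ² ≈⟨ solve 2 (λ x d → con 2 :* con 2 :* (x :* (x :+ d)) :+ d :* d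
                                    := (x :+ (x :+ d)) :* (x :+ (x :+ d))) refl x d ⟩
    (x + (x + d)) ²            ≈⟨ *-cong (+-congˡ x+d≈y) (+-congˡ x+d≈y) ⟩
    (x + y) ²                  ∎
    where
    d = y - x
    x+d≈y = difference x y

  -- `P`, `S` and `T` stand for the three sums over the remaining indices. After expanding, the
  -- diagonal terms agree, `P ² ≤ S * T` is the induction hypothesis, and only the cross terms need
  -- an argument.
  cauchy-schwarz-step : ∀ {w x y P S T} → 0# ≤ w → 0# ≤ S → 0# ≤ T → P ² ≤ S * T →
    (w * (x * y) + P) ² ≤ (w * x ² + S) * (w * y ² + T)
  cauchy-schwarz-step {w} {x} {y} {P} {S} {T} 0≤w 0≤S 0≤T P²≤ST = begin
    (w * (x * y) + P) ²
      ≈⟨ solve 4 (λ w x y P → (w :* (x :* y) :+ P) :* (w :* (x :* y) :+ P)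
           := w :* x :* x :* w :* y :* y :+ w :* (con 2 :* (P :* (x :* y))) :+ P :* P) refl w x y P ⟩
    w * x * x * w * y * y + w * (2# * (P * (x * y))) + P ²
      ≤⟨ +-mono-≤ (+-monoʳ-≤ _ (*-monoʳ-≤ 0≤w cross)) P²≤ST ⟩
    w * x * x * w * y * y + w * (S * y ² + T * x ²) + S * T
      ≈⟨ solve 5 (λ w x y S T →
           w :* x :* x :* w :* y :* y :+ w :* (S :* (y :* y) :+ T :* (x :* x)) :+ S :* T
           := (w :* (x :* x) :+ S) :* (w :* (y :* y) :+ T)) refl w x y S T ⟩
    (w * x ² + S) * (w * y ² + T) ∎
    where
    cross : 2# * (P * (x * y)) ≤ S * y ² + T * x ²
    -- Comparing squares avoids roots of `S` and `T`: the induction hypothesis replaces `P ²` by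
    -- `S * T`, and the mean inequality is then applied to `S * y ²` and `T * x ²`.
    cross = ²-cancel-≤ (+-nonNegative 0≤Sy² 0≤Tx²) (begin
      (2# * (P * (x * y))) ²
        ≈⟨ solve 3 (λ x y P → (con 2 :* (P :* (x :* y))) :* (con 2 :* (P :* (x :* y)))
             := P :* P :* ((con 2 :* con 2) :* (x :* x :* (y :* y)))) refl x y P ⟩
      P ² * (2# ² * (x ² * y ²))
        ≤⟨ *-monoˡ-≤ (*-nonNegative (0≤x² 2#) (*-nonNegative (0≤x² x) (0≤x² y))) P²≤ST ⟩
      S * T * (2# ² * (x ² * y ²))
        ≈⟨ solve 4 (λ x y S T → S :* T :* ((con 2 :* con 2) :* (x :* x :* (y :* y)))
             := (con 2 :* con 2) :* (S :* (y :* y) :* (T :* (x :* x)))) refl x y S T ⟩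
      2# ² * (S * y ² * (T * x ²))
        ≤⟨ 4xy≤[x+y]² (S * y ²) (T * x ²) ⟩
      (S * y ² + T * x ²) ² ∎)
      where
      0≤Sy² = *-nonNegative 0≤S (0≤x² y)
      0≤Tx² = *-nonNegative 0≤T (0≤x² x)

  cauchy-schwarz : ∀ {n} {w x y : Vector Carrier n} → (∀ i → 0# ≤ w i) →
    (∑[ i < n ] (w i * (x i * y i))) ² ≤
    (∑[ i < n ] (w i * x i ²)) * (∑[ i < n ] (w i * y i ²))
  cauchy-schwarz {zero}  0≤w = ≤-refl
  cauchy-schwarz {suc n} {w} {x} {y} 0≤w = cauchy-schwarz-step (0≤w zero)
    (sum-nonNegative λ i → *-nonNegative (0≤w (suc i)) (0≤x² (x (suc i))))
    (sum-nonNegative λ i → *-nonNegative (0≤w (suc i)) (0≤x² (y (suc i))))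
    (cauchy-schwarz (0≤w ∘ suc))

-- Finite measures in place of integration over the level, and averaging.

module Layers {ℓ} (ℝ : CompleteOrderedField ℓ) where
  open CompleteOrderedField ℝ
  open OrderedField ℝ
  open HypergraphTheory ℝ using (𝟙)
  open SemiringSum (CommutativeRing.semiring commutativeRing)
    using (∑-distrib-+; *-distribˡ-sum; ∑-comm; sum-cong-≋)
  open Solver commutativeSemiring using (solve; _:+_; _:*_; _:=_; con)
  open DecTotalOrder decTotalOrder using (poset)
  open PartialOrderReasoning poset
  open CommutativeRing commutativeRing using (reflexive)
  open StrictTotalOrder (OrderProperties.<-strictTotalOrder decTotalOrder) using (_<?_)
  open Sort decTotalOrder using (sort; sort-↭; sort-↗)
  open SortedList totalOrder using (Sorted)

  𝟙-yes : ∀ {a} {A : Set a} (A? : Dec A) → A → 𝟙 A? ≡ 1#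
  𝟙-yes (yes _) _ = ≡.refl
  𝟙-yes (no ¬a) a = contradiction a ¬a

  𝟙-no : ∀ {a} {A : Set a} (A? : Dec A) → ¬ A → 𝟙 A? ≡ 0#
  𝟙-no (yes a) ¬a = contradiction a ¬a
  𝟙-no (no _)  _  = ≡.refl

  0≤𝟙 : ∀ {a} {A : Set a} (A? : Dec A) → 0# ≤ 𝟙 A?
  0≤𝟙 (yes _) = 0≤1
  0≤𝟙 (no _)  = ≤-refl

  𝟙≤1 : ∀ {a} {A : Set a} (A? : Dec A) → 𝟙 A? ≤ 1#
  𝟙≤1 (yes _) = ≤-refl
  𝟙≤1 (no _)  = 0≤1

  𝟙-mono : ∀ {a b} {A : Set a} {B : Set b} (A? : Dec A) (B? : Dec B) →
           (A → B) → 𝟙 A? ≤ 𝟙 B?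
  𝟙-mono (yes a) B? f = ≤-reflexive (reflexive (≡.sym (𝟙-yes B? (f a))))
  𝟙-mono (no _)  B? f = 0≤𝟙 B?

  -- A finite measure on the positive numbers, with atoms p j at the points s j,
  -- for which every interval (0, y] with y ∈ˡ ys has measure y.
  record LayerCake (ys : List Carrier) : Set ℓ where
    field
      size       : ℕ
      p s        : Vector Carrier size
      p-positive : ∀ j → 0# < p j
      s-positive : ∀ j → 0# < s j

    ∫ : (Carrier → Carrier) → Carrier
    ∫ φ = ∑[ j < size ] (p j * φ (s j))

    field
      ∫-𝟙 : ∀ {y} → y ∈ˡ ys → ∫ (λ t → 𝟙 (t ≤? y)) ≈ y

    -- The comparison is asked for at positive `t` only, because the sets L and R of a level are
    -- disjoint only there: for `t ≤ 0#` every vertex lies in both, as `q` is nonnegative.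
    ∫-mono : ∀ {φ ψ} → (∀ t → 0# < t → φ t ≤ ψ t) → ∫ φ ≤ ∫ ψ
    ∫-mono φ≤ψ = sum-mono-≤ λ j →
      *-monoʳ-≤ (proj₁ (p-positive j)) (φ≤ψ (s j) (s-positive j))

    ∫-cong : ∀ {φ ψ} → (∀ t → 0# < t → φ t ≈ ψ t) → ∫ φ ≈ ∫ ψ
    ∫-cong φ≈ψ = sum-cong-≋ λ j → *-congˡ (φ≈ψ (s j) (s-positive j))

    ∫-+ : ∀ φ ψ → ∫ (λ t → φ t + ψ t) ≈ ∫ φ + ∫ ψ
    ∫-+ φ ψ = trans (sum-cong-≋ λ j → distribˡ (p j) (φ (s j)) (ψ (s j)))
      (∑-distrib-+ (λ j → p j * φ (s j)) (λ j → p j * ψ (s j)))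

    -- Fubini for finite sums. It reduces the integrated volume to single vertices and the
    -- integrated numerator to single edges.
    ∫-sum : ∀ {n} (w : Vector Carrier n) (φ : Fin n → Carrier → Carrier) →
            ∫ (λ t → ∑[ i < n ] (w i * φ i t)) ≈ ∑[ i < n ] (w i * ∫ (φ i))
    ∫-sum {n} w φ = begin-equality
      ∑[ j < size ] (p j * ∑[ i < n ] (w i * φ i (s j)))
        ≈⟨ sum-cong-≋ (λ j → *-distribˡ-sum (p j) (λ i → w i * φ i (s j))) ⟩
      ∑[ j < size ] ∑[ i < n ] (p j * (w i * φ i (s j)))
        ≈⟨ ∑-comm (λ j i → p j * (w i * φ i (s j))) ⟩
      ∑[ i < n ] ∑[ j < size ] (p j * (w i * φ i (s j)))
        ≈⟨ sum-cong-≋ (λ i → sum-cong-≋ λ j →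
             solve 3 (λ p w x → p :* (w :* x) := w :* (p :* x)) refl (p j) (w i) (φ i (s j))) ⟩
      ∑[ i < n ] ∑[ j < size ] (w i * (p j * φ i (s j)))
        ≈⟨ sum-cong-≋ (λ i → *-distribˡ-sum (w i) (λ j → p j * φ i (s j))) ⟨
      ∑[ i < n ] (w i * ∑[ j < size ] (p j * φ i (s j))) ∎

  -- The part of a layer cake above base, for a sorted list starting at base.
  record Chain (base : Carrier) (ys : List Carrier) : Set ℓ where
    field
      size       : ℕ
      p s        : Vector Carrier size
      p-positive : ∀ j → 0# < p j
      base<s     : ∀ j → base < s j
      measure    : ∀ {y} → y ∈ˡ ys → base + ∑[ j < size ] (p j * 𝟙 (s j ≤? y)) ≈ y

    measure-below : ∀ {y} → y ≤ base → ∑[ j < size ] (p j * 𝟙 (s j ≤? y)) ≈ 0#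
    measure-below {y} y≤base = sum-zero λ j → trans
      (*-congˡ (reflexive (𝟙-no (s j ≤? y) (<⇒≱ (≤-<-trans y≤base (base<s j))))))
      (zeroʳ (p j))

  -- Each strict rise in the sorted list, from `base` to `x`, gets an atom at `x` of mass
  -- `x - base`. The masses up to a listed value then telescope to that value.
  chain : ∀ base ys → Sorted (base ∷ ys) → Chain base (base ∷ ys)
  chain base [] _ = record
    { size = 0; p = λ (); s = λ (); p-positive = λ (); base<s = λ ()
    ; measure = λ { (here ≡.refl) → +-identityʳ base } }
  chain base (x ∷ ys) (base≤x ∷ sorted) with x ≤? base
  -- A repeated value: an atom here would have mass zero, but masses must be positive, so none is
  -- added.
  ... | yes x≤base = record
    { size = size; p = p; s = s; p-positive = p-positive
    ; base<s = λ j → ≤-<-trans base≤x (base<s j)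
    ; measure = λ
      { (here ≡.refl) → trans (+-congˡ (measure-below base≤x)) (+-identityʳ base)
      ; (there y∈)    → trans (+-congʳ (antisym base≤x x≤base)) (measure y∈) } }
    where open Chain (chain x ys sorted)
  ... | no x≰base = record
    { size = suc size; p = (x - base) V.∷ p; s = x V.∷ s
    ; p-positive = λ { zero → 0<x-base ; (suc j) → p-positive j }
    ; base<s = λ { zero → base<x ; (suc j) → <-trans base<x (base<s j) }
    ; measure = λ
      { (here ≡.refl) → begin-equality
          base + ((x - base) * 𝟙 (x ≤? base) + _)
            ≈⟨ +-congˡ (+-cong (*-congˡ (reflexive (𝟙-no (x ≤? base) x≰base))) (measure-below base≤x)) ⟩
          base + ((x - base) * 0# + 0#)
            ≈⟨ solve 2 (λ b d → b :+ (d :* con 0 :+ con 0) := b) refl base (x - base) ⟩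
          base ∎
      -- Sortedness puts `y` at or above `x`, so the new atom counts in full and lifts the base from
      -- `base` to `x`, where the recursive chain takes over.
      ; {y} (there y∈) → begin-equality
          base + ((x - base) * 𝟙 (x ≤? y) + _)
            ≈⟨ +-congˡ (+-congʳ (*-congˡ (reflexive (𝟙-yes (x ≤? y) (All.lookup x≤ys y∈))))) ⟩
          base + ((x - base) * 1# + _)
            ≈⟨ solve 3 (λ b d J → b :+ (d :* con 1 :+ J) := b :+ d :+ J) refl base (x - base) _ ⟩
          base + (x - base) + _
            ≈⟨ +-congʳ (difference base x) ⟩
          x + _
            ≈⟨ measure y∈ ⟩
          y ∎ } }
    where
    open Chain (chain x ys sorted)
    base<x = ≰⇒> x≰base
    0<x-base : 0# < x - base
    0<x-base = 0≤difference base≤x , λ 0≈x-base → proj₂ base<x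
      (trans (sym (+-identityʳ base)) (trans (+-congˡ 0≈x-base) (difference base x)))
    x≤ys : All (x ≤_) (x ∷ ys)
    x≤ys = Linked⇒All ≤-trans ≤-refl sorted

  -- The chain starts at zero, below all values, so that the base contributes nothing and every atom
  -- is positive. Sorting only permutes the list and so keeps membership.
  layerCake : ∀ ys → All (0# ≤_) ys → LayerCake ys
  layerCake ys 0≤ys = record
    { size = size; p = p; s = s; p-positive = p-positive; s-positive = base<s
    ; ∫-𝟙 = λ y∈ → trans (sym (+-identityˡ _))
        (measure (there (∈-resp-↭ (↭-sym (sort-↭ ys)) y∈))) }
    where
    sorted : ∀ {xs} → All (0# ≤_) xs → Sorted xs → Sorted (0# ∷ xs)
    sorted []       _   = [-]
    sorted (0≤x ∷ _) xs↗ = 0≤x ∷ xs↗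
    open Chain (chain 0# (sort ys)
      (sorted (All-resp-↭ (↭-sym (sort-↭ ys)) 0≤ys) (sort-↗ ys)))

  -- If every index with positive `y` failed, then `θ * y j ≤ x j` throughout, so the weighted gaps
  -- are nonnegative while their sum is at most zero. All gaps vanish, so `x j ≤ θ * y j` holds
  -- after all; hence no `y j` is positive, against the positive total. Positivity of the chosen
  -- `y j` will make it a legitimate denominator.
  exists-below-average : ∀ {k θ} {p x y : Vector Carrier k} →
    (∀ j → 0# < p j) → (∀ j → 0# ≤ x j) → (∀ j → 0# ≤ y j) →
    0# < ∑[ j < k ] (p j * y j) →
    ∑[ j < k ] (p j * x j) ≤ θ * ∑[ j < k ] (p j * y j) →
    ∃[ j ] 0# < y j × x j ≤ θ * y j
  exists-below-average {k} {θ} {p} {x} {y} 0<p 0≤x 0≤y 0<Y X≤θY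
    with any? (λ j → 0# <? y j ×-dec x j ≤? θ * y j)
  ... | yes found = found
  ... | no  none  = contradiction (≤-reflexive (sum-zero py≈0)) (<⇒≱ 0<Y)
    where
    θy≤x : ∀ j → θ * y j ≤ x j
    θy≤x j with 0# <? y j
    ... | yes 0<y = proj₁ (≰⇒> λ x≤θy → none (j , 0<y , x≤θy))
    ... | no  0≮y = begin
      θ * y j ≈⟨ *-congˡ (antisym (≮⇒≥ 0≮y) (0≤y j)) ⟩
      θ * 0#  ≈⟨ zeroʳ θ ⟩
      0#      ≤⟨ 0≤x j ⟩
      x j     ∎
    gap : Vector Carrier k
    gap j = p j * (x j - θ * y j)
    θY≈ : θ * ∑[ j < k ] (p j * y j) ≈ ∑[ j < k ] (p j * (θ * y j))
    θY≈ = trans (*-distribˡ-sum θ (λ j → p j * y j)) (sum-cong-≋ λ j →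
      solve 3 (λ θ p y → θ :* (p :* y) := p :* (θ :* y)) refl θ (p j) (y j))
    ∑gap≤0 : sum gap ≤ 0#
    ∑gap≤0 = +-cancelʳ-≤ (θ * ∑[ j < k ] (p j * y j)) (begin
      sum gap + θ * ∑[ j < k ] (p j * y j)   ≈⟨ +-congˡ θY≈ ⟩
      sum gap + ∑[ j < k ] (p j * (θ * y j)) ≈⟨ ∑-distrib-+ gap (λ j → p j * (θ * y j)) ⟨
      ∑[ j < k ] (gap j + p j * (θ * y j))   ≈⟨ sum-cong-≋ refill ⟩
      ∑[ j < k ] (p j * x j)                 ≤⟨ X≤θY ⟩
      θ * ∑[ j < k ] (p j * y j)             ≈⟨ +-identityˡ _ ⟨
      0# + θ * ∑[ j < k ] (p j * y j)        ∎)
      where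
      refill : ∀ j → gap j + p j * (θ * y j) ≈ p j * x j
      refill j = trans (sym (distribˡ (p j) _ _))
        (*-congˡ (trans (+-comm _ _) (difference (θ * y j) (x j))))
    x≤θy : ∀ j → x j ≤ θ * y j
    x≤θy j = begin
      x j                       ≈⟨ difference (θ * y j) (x j) ⟨
      θ * y j + (x j - θ * y j) ≤⟨ +-monoʳ-≤ (θ * y j) gap≤0 ⟩
      θ * y j + 0#              ≈⟨ +-identityʳ _ ⟩
      θ * y j                   ∎
      where
      0≤gap : ∀ i → 0# ≤ gap i
      0≤gap i = *-nonNegative (proj₁ (0<p i)) (0≤difference (θy≤x i))
      gap≤0 : x j - θ * y j ≤ 0#
      gap≤0 = *-cancelʳ-≤ (0<p j) (begin
        (x j - θ * y j) * p j ≈⟨ *-comm _ _ ⟩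
        gap j                 ≤⟨ term≤sum 0≤gap j ⟩
        sum gap               ≤⟨ ∑gap≤0 ⟩
        0#                    ≈⟨ zeroˡ (p j) ⟨
        0# * p j              ∎)
    py≈0 : ∀ j → p j * y j ≈ 0#
    py≈0 j = trans (*-congˡ (antisym (≮⇒≥ λ 0<y → none (j , 0<y , x≤θy j)) (0≤y j))) (zeroʳ (p j))

module Rounding {ℓ} (ℝ : CompleteOrderedField ℓ) where
  open CompleteOrderedField ℝ
  open OrderedField ℝ
  open Layers ℝ
  open HypergraphTheory ℝ
  open CommutativeRing commutativeRing using (reflexive)
  open Extrema totalOrder using (argmax-sel; argmin-sel; xs≤max; min≤xs)
  open Max totalOrder using (x≤y⇒x⊔y≈y; ⊔-monoˡ-≤)
  open SemiringSum (CommutativeRing.semiring commutativeRing)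
    using (∑-distrib-+; *-distribˡ-sum; ∑-comm; sum-cong-≋)
  open Solver commutativeSemiring using (solve; _:+_; _:*_; _:=_; con)
  open DecTotalOrder decTotalOrder using (poset)
  open PartialOrderReasoning poset

  -- Extrema over an edge, the truncated square and its level sets.

  ∈-elements : ∀ {n} {S : Subset n} {x} → x ∈ S → x ∈ˡ elements S
  ∈-elements {S = S} {x} x∈S = ∈-filter⁺ (_∈? S) (∈-allFin x) x∈S

  -- The default value is taken at a vertex of `S`, so the maximum is attained in `S` whether it
  -- comes from the default or from the list. The equation is propositional so that it can later be
  -- matched away.
  maxOver-attained : ∀ {n} (f : Vector Carrier n) (S : Subset n) (ne : Nonempty S) →
    ∃[ u ] u ∈ S × maxOver f S ne ≡ f u × (∀ {x} → x ∈ S → f x ≤ f u)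
  maxOver-attained f S ne@(v , v∈S) =
    let u , u∈S , max≡fu = attained (argmax-sel id (f v) (map f (elements S)))
    in u , u∈S , max≡fu , λ {x} x∈S → ≡.subst (f x ≤_) max≡fu
         (All.lookup (xs≤max (f v) (map f (elements S))) (∈-map⁺ f (∈-elements x∈S)))
    where
    attained : maxOver f S ne ≡ f v ⊎ maxOver f S ne ∈ˡ map f (elements S) →
               ∃[ u ] u ∈ S × maxOver f S ne ≡ f u
    attained (inj₁ max≡fv) = v , v∈S , max≡fv
    attained (inj₂ max∈) = let u , u∈ , max≡fu = ∈-map⁻ f max∈ in
      u , proj₂ (∈-filter⁻ (_∈? S) {xs = allFin _} u∈) , max≡fu

  minOver-attained : ∀ {n} (f : Vector Carrier n) (S : Subset n) (ne : Nonempty S) →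
    ∃[ u ] u ∈ S × minOver f S ne ≡ f u × (∀ {x} → x ∈ S → f u ≤ f x)
  minOver-attained f S ne@(v , v∈S) =
    let u , u∈S , min≡fu = attained (argmin-sel id (f v) (map f (elements S)))
    in u , u∈S , min≡fu , λ {x} x∈S → ≡.subst (_≤ f x) min≡fu
         (All.lookup (min≤xs (f v) (map f (elements S))) (∈-map⁺ f (∈-elements x∈S)))
    where
    attained : minOver f S ne ≡ f v ⊎ minOver f S ne ∈ˡ map f (elements S) →
               ∃[ u ] u ∈ S × minOver f S ne ≡ f u
    attained (inj₁ min≡fv) = v , v∈S , min≡fv
    attained (inj₂ min∈) = let u , u∈ , min≡fu = ∈-map⁻ f min∈ in
      u , proj₂ (∈-filter⁻ (_∈? S) {xs = allFin _} u∈) , min≡fu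

  q : Carrier → Carrier
  q x = (x ⊔ 0#) ²

  0≤q : ∀ x → 0# ≤ q x
  0≤q x = 0≤x² (x ⊔ 0#)

  q-mono-≤ : ∀ {x y} → x ≤ y → q x ≤ q y
  q-mono-≤ {x} {y} x≤y = ²-mono-≤ (x≤y⊔x x 0#) (⊔-monoˡ-≤ 0# x≤y)

  0≤x⇒q≈x² : ∀ {x} → 0# ≤ x → q x ≈ x ²
  0≤x⇒q≈x² 0≤x = *-cong (x≤y⇒y⊔x≈y 0≤x) (x≤y⇒y⊔x≈y 0≤x)

  x≤0⇒q≈0 : ∀ {x} → x ≤ 0# → q x ≈ 0#
  x≤0⇒q≈0 x≤0 = trans (*-cong (x≤y⇒x⊔y≈y x≤0) (x≤y⇒x⊔y≈y x≤0)) (zeroˡ 0#)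

  0<q⇒0<x : ∀ {x} → 0# < q x → 0# < x
  0<q⇒0<x 0<q = ≰⇒> λ x≤0 → <⇒≉ 0<q (sym (x≤0⇒q≈0 x≤0))

  -- One of the two positive parts is zero and the other is the absolute value. This is why the
  -- integrated volume is the degree-weighted square norm.
  q-opposite : ∀ {x y} → x + y ≈ 0# → q x + q y ≈ x ²
  q-opposite {x} {y} x+y≈0 = [ nonNegative , nonPositive ]′ (total 0# x)
    where
    nonNegative : 0# ≤ x → q x + q y ≈ x ²
    nonNegative 0≤x = trans
      (+-cong (0≤x⇒q≈x² 0≤x) (x≤0⇒q≈0 (x+y≈0∧0≤x⇒y≤0 x+y≈0 0≤x))) (+-identityʳ _)
    nonPositive : x ≤ 0# → q x + q y ≈ x ²
    nonPositive x≤0 = trans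
      (+-cong (x≤0⇒q≈0 x≤0) (0≤x⇒q≈x² (x+y≈0∧x≤0⇒0≤y x+y≈0 x≤0)))
      (trans (+-identityˡ _) (sym (x+y≈0⇒x²≈y² x+y≈0)))

  level : ∀ {n} → Vector Carrier n → Carrier → Subset n
  level g t = Vec.tabulate λ v → does (t ≤? g v)

  ∈-level⁺ : ∀ {n} (g : Vector Carrier n) {t v} → t ≤ g v → v ∈ level g t
  ∈-level⁺ g {t} {v} t≤gv = lookup⇒[]= v _
    (≡.trans (lookup∘tabulate _ v) (dec-true (t ≤? g v) t≤gv))

  ∈-level⁻ : ∀ {n} (g : Vector Carrier n) {t v} → v ∈ level g t → t ≤ g v
  ∈-level⁻ g {t} {v} v∈ = true⇒ (t ≤? g v)
    (≡.trans (≡.sym (lookup∘tabulate _ v)) ([]=⇒lookup v∈))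
    where
    true⇒ : (A? : Dec (t ≤ g v)) → does A? ≡ true → t ≤ g v
    true⇒ (yes t≤gv) _ = t≤gv

  -- The negative of f is carried as a separate vector f⁻, so that a statement about
  -- f and f⁻ can be reused with the two exchanged (- (- f v) is only ≈ to f v).
  level-disjoint : ∀ {n} {f f⁻ : Vector Carrier n} → (∀ v → f v + f⁻ v ≈ 0#) →
    ∀ {t} → 0# < t → Empty (level (q ∘ f) t ∩ level (q ∘ f⁻) t)
  level-disjoint {f = f} {f⁻} f+f⁻≈0 0<t (v , v∈) =
    <⇒≱ (positive f⁻ (proj₂ v∈₂)) (x+y≈0∧0≤x⇒y≤0 (f+f⁻≈0 v) (proj₁ (positive f (proj₁ v∈₂))))
    where
    v∈₂ = x∈p∩q⁻ _ _ v∈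
    positive : ∀ g → v ∈ level (q ∘ g) _ → 0# < g v
    positive g v∈ = 0<q⇒0<x (<-≤-trans 0<t (∈-level⁻ (q ∘ g) v∈))

  𝟙-∪ : ∀ {n} {L R : Subset n} → Empty (L ∩ R) →
        ∀ v → 𝟙 (v ∈? L ∪ R) ≈ 𝟙 (v ∈? L) + 𝟙 (v ∈? R)
  𝟙-∪ {L = L} {R} L∩R≡∅ v with v ∈? L | v ∈? R
  ... | yes v∈L | yes v∈R = contradiction (v , x∈p∩q⁺ (v∈L , v∈R)) L∩R≡∅
  ... | yes v∈L | no  _   =
    trans (reflexive (𝟙-yes (v ∈? L ∪ R) (x∈p∪q⁺ (inj₁ v∈L)))) (sym (+-identityʳ 1#))
  ... | no  _   | yes v∈R =
    trans (reflexive (𝟙-yes (v ∈? L ∪ R) (x∈p∪q⁺ (inj₂ v∈R)))) (sym (+-identityˡ 1#))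
  ... | no v∉L  | no v∉R  =
    trans (reflexive (𝟙-no (v ∈? L ∪ R) λ v∈ → ∉∪ (x∈p∪q⁻ L R v∈))) (sym (+-identityʳ 0#))
    where
    ∉∪ : ¬ (v ∈ L ⊎ v ∈ R)
    ∉∪ (inj₁ v∈L) = v∉L v∈L
    ∉∪ (inj₂ v∈R) = v∉R v∈R

  -- What one edge contributes at one level.

  edgeCut : ∀ {n} (S A B C : Subset n) → Carrier
  edgeCut S A B C = 𝟙 (nonempty? (S ∩ A) ×-dec nonempty? (S ∩ B) ×-dec ¬? (nonempty? (S ∩ C)))

  contribution : ∀ {n} (L R S : Subset n) → Carrier
  contribution L R S =
    2# * edgeCut S L L (∁ L) + 2# * edgeCut S R R (∁ R)
      + edgeCut S L (∁ (L ∪ R)) R + edgeCut S R (∁ (L ∪ R)) L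

  0≤edgeCut : ∀ {n} (S A B C : Subset n) → 0# ≤ edgeCut S A B C
  0≤edgeCut S A B C =
    0≤𝟙 (nonempty? (S ∩ A) ×-dec nonempty? (S ∩ B) ×-dec ¬? (nonempty? (S ∩ C)))

  0≤contribution : ∀ {n} (L R S : Subset n) → 0# ≤ contribution L R S
  0≤contribution L R S = +-nonNegative (+-nonNegative (+-nonNegative
    (*-nonNegative 0≤2 (0≤edgeCut S L L (∁ L)))
    (*-nonNegative 0≤2 (0≤edgeCut S R R (∁ R))))
    (0≤edgeCut S L (∁ (L ∪ R)) R))
    (0≤edgeCut S R (∁ (L ∪ R)) L)

  -- Exchanging `f` with its negative exchanges L and R; this symmetry carries the bound over to
  -- edges whose maximum and minimum have a negative sum.
  contribution-swap : ∀ {n} (L R S : Subset n) → contribution L R S ≈ contribution R L S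
  contribution-swap L R S rewrite ∪-comm L R =
    solve 4 (λ a b c d → con 2 :* a :+ con 2 :* b :+ c :+ d
      := con 2 :* b :+ con 2 :* a :+ d :+ c) refl
      (edgeCut S L L (∁ L)) (edgeCut S R R (∁ R))
      (edgeCut S L (∁ (R ∪ L)) R) (edgeCut S R (∁ (R ∪ L)) L)

  -- u and v stand for vertices of S maximising and minimising f, with f u + f v ≥ 0.
  contribution-bound : ∀ {n} {L R S : Subset n} {u v} → u ∈ S → v ∈ S → Empty (L ∩ R) →
    (∀ {x} → x ∈ S → x ∈ L → u ∈ L) → (∀ {x} → x ∈ S → v ∈ L → x ∈ L) →
    (∀ {x} → x ∈ S → x ∈ R → v ∈ R) → (v ∈ R → u ∈ L) →
    contribution L R S + 𝟙 (v ∈? R) ≤ 𝟙 (u ∈? L) + 𝟙 (v ∈? L)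
  contribution-bound {L = L} {R} {S} {u} {v} u∈S v∈S L∩R≡∅ L↑ L↓ R↓ R⇒L = bound (v ∈? R) (v ∈? L)
    where
    disjoint : ∀ {x} → x ∈ L → x ∈ R → ⊥
    disjoint x∈L x∈R = L∩R≡∅ (_ , x∈p∩q⁺ (x∈L , x∈R))
    L-meets⇒u∈L : Nonempty (S ∩ L) → u ∈ L
    L-meets⇒u∈L (x , x∈) = let x∈S , x∈L = x∈p∩q⁻ S L x∈ in L↑ x∈S x∈L
    R-meets⇒v∈R : Nonempty (S ∩ R) → v ∈ R
    R-meets⇒v∈R (x , x∈) = let x∈S , x∈R = x∈p∩q⁻ S R x∈ in R↓ x∈S x∈R
    R-meets⇒u∈L : Nonempty (S ∩ R) → u ∈ L
    R-meets⇒u∈L = R⇒L ∘ R-meets⇒v∈R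
    inside-L? = nonempty? (S ∩ L) ×-dec nonempty? (S ∩ L) ×-dec ¬? (nonempty? (S ∩ ∁ L))
    inside-R? = nonempty? (S ∩ R) ×-dec nonempty? (S ∩ R) ×-dec ¬? (nonempty? (S ∩ ∁ R))
    leaves-L? = nonempty? (S ∩ L) ×-dec nonempty? (S ∩ ∁ (L ∪ R)) ×-dec ¬? (nonempty? (S ∩ R))
    leaves-R? = nonempty? (S ∩ R) ×-dec nonempty? (S ∩ ∁ (L ∪ R)) ×-dec ¬? (nonempty? (S ∩ L))

    inside-L⇒v∈L : ¬ Nonempty (S ∩ ∁ L) → v ∈ L
    inside-L⇒v∈L S⊆L with v ∈? L
    ... | yes v∈L = v∈L
    ... | no  v∉L = contradiction (v , x∈p∩q⁺ (v∈S , x∉p⇒x∈∁p v∉L)) S⊆L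
    -- An edge meeting `R` has `v` in `R` and therefore `u` in `L`. So it neither lies inside `R`
    -- nor misses `L`, and the two terms led by `R` vanish.
    not-inside-R : 𝟙 inside-R? ≡ 0#
    not-inside-R = 𝟙-no inside-R? λ (meets , _ , S⊆R) →
      S⊆R (u , x∈p∩q⁺ (u∈S , x∉p⇒x∈∁p (disjoint (R-meets⇒u∈L meets))))
    not-leaves-R : 𝟙 leaves-R? ≡ 0#
    not-leaves-R = 𝟙-no leaves-R? λ (meets , _ , misses) →
      misses (u , x∈p∩q⁺ (u∈S , R-meets⇒u∈L meets))

    assemble : ∀ {a c d rhs} → 𝟙 inside-L? ≤ a → 𝟙 leaves-L? ≤ c → 𝟙 (v ∈? R) ≤ d →
      2# * a + c + d ≤ rhs → contribution L R S + 𝟙 (v ∈? R) ≤ rhs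
    assemble {a} {c} {d} {rhs} ≤a ≤c ≤d ≤rhs = begin
      contribution L R S + 𝟙 (v ∈? R)
        ≤⟨ +-mono-≤ (+-mono-≤ (+-mono-≤ (+-mono-≤ (*-monoʳ-≤ 0≤2 ≤a)
             (*-monoʳ-≤ 0≤2 (≤-reflexive (reflexive not-inside-R)))) ≤c)
             (≤-reflexive (reflexive not-leaves-R))) ≤d ⟩
      2# * a + 2# * 0# + c + 0# + d
        ≈⟨ solve 3 (λ a c d → con 2 :* a :+ con 2 :* con 0 :+ c :+ con 0 :+ d
             := con 2 :* a :+ c :+ d) refl a c d ⟩
      2# * a + c + d
        ≤⟨ ≤rhs ⟩
      rhs ∎

    zero-𝟙 : ∀ {a} {A : Set a} (A? : Dec A) → ¬ A → 𝟙 A? ≤ 0#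
    zero-𝟙 A? ¬a = ≤-reflexive (reflexive (𝟙-no A? ¬a))

    bound : Dec (v ∈ R) → Dec (v ∈ L) → contribution L R S + 𝟙 (v ∈? R) ≤ 𝟙 (u ∈? L) + 𝟙 (v ∈? L)
    -- The edge meets both sets and contributes nothing; the extra indicator of `v` in `R` is paid
    -- for by `u` in `L`.
    bound (yes v∈R) _ = assemble
      (zero-𝟙 inside-L? λ (_ , _ , S⊆L) → disjoint (inside-L⇒v∈L S⊆L) v∈R)
      (zero-𝟙 leaves-L? λ (_ , _ , misses) → misses (v , x∈p∩q⁺ (v∈S , v∈R)))
      (𝟙≤1 (v ∈? R)) (begin
        2# * 0# + 0# + 1#         ≈⟨ solve 0 (con 2 :* con 0 :+ con 0 :+ con 1 := con 1) refl ⟩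
        1#                        ≈⟨ reflexive (𝟙-yes (u ∈? L) (R⇒L v∈R)) ⟨
        𝟙 (u ∈? L)                ≤⟨ x≤x+y _ (0≤𝟙 (v ∈? L)) ⟩
        𝟙 (u ∈? L) + 𝟙 (v ∈? L)   ∎)
    -- With the minimiser in `L` the whole edge lies in `L`; its contribution of two is paid for by
    -- `u` and `v`.
    bound (no v∉R) (yes v∈L) = assemble
      (𝟙≤1 inside-L?)
      (zero-𝟙 leaves-L? λ { (_ , (x , x∈) , _) → let x∈S , x∈∁ = x∈p∩q⁻ S _ x∈ in
        x∈∁p⇒x∉p x∈∁ (x∈p∪q⁺ (inj₁ (L↓ x∈S v∈L))) })
      (zero-𝟙 (v ∈? R) v∉R) (begin
        2# * 1# + 0# + 0#         ≈⟨ solve 0 (con 2 :* con 1 :+ con 0 :+ con 0 := con 2) refl ⟩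
        1# + 1#                   ≈⟨ +-cong (reflexive (𝟙-yes (u ∈? L) (L↑ v∈S v∈L)))
                                            (reflexive (𝟙-yes (v ∈? L) v∈L)) ⟨
        𝟙 (u ∈? L) + 𝟙 (v ∈? L)   ∎)
    -- The edge is not inside `L`, so at most the term for leaving `L` remains, and that term
    -- requires `u` in `L`.
    bound (no v∉R) (no v∉L) = assemble
      (zero-𝟙 inside-L? λ (_ , _ , S⊆L) → v∉L (inside-L⇒v∈L S⊆L))
      (𝟙-mono leaves-L? (u ∈? L) (L-meets⇒u∈L ∘ proj₁))
      (zero-𝟙 (v ∈? R) v∉R) (begin
        2# * 0# + 𝟙 (u ∈? L) + 0# ≈⟨ solve 1 (λ a → con 2 :* con 0 :+ a :+ con 0 := a) refl (𝟙 (u ∈? L)) ⟩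
        𝟙 (u ∈? L)                ≤⟨ x≤x+y _ (0≤𝟙 (v ∈? L)) ⟩
        𝟙 (u ∈? L) + 𝟙 (v ∈? L)   ∎)

  -- Factoring the bound for an edge, and the energy of an edge.

  opposite-antitone : ∀ {x x⁻ y y⁻} → x + x⁻ ≈ 0# → y + y⁻ ≈ 0# → x ≤ y → y⁻ ≤ x⁻
  opposite-antitone {x} {x⁻} {y} {y⁻} x+x⁻≈0 y+y⁻≈0 x≤y = +-cancelʳ-≤ y (begin
    y⁻ + y ≈⟨ +-comm y⁻ y ⟩
    y + y⁻ ≈⟨ y+y⁻≈0 ⟩
    0#     ≈⟨ x+x⁻≈0 ⟨
    x + x⁻ ≤⟨ +-monoˡ-≤ x⁻ x≤y ⟩
    y + x⁻ ≈⟨ +-comm y x⁻ ⟩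
    x⁻ + y ∎)

  -- Here `a` and `b` are the extrema on the edge, `b⁻` is the negative of `b`, `I` is the
  -- integrated contribution and `M` the energy. If `b` is nonnegative, `c` is `a`, since a² + b² ≤
  -- (a + b)a. Otherwise `c` is a - b, since a² - b² = (a + b)(a - b).
  edge-algebra : ∀ {a b b⁻ I M} → b + b⁻ ≈ 0# → b ≤ a → 0# ≤ a + b →
    I + q b⁻ ≤ q a + q b → a ² ≤ M → a ≡ b ⊎ a ² + b ² ≤ M →
    ∃[ c ] c ² ≤ 2# * M × I ≤ (a + b) * c
  edge-algebra {a} {b} {b⁻} {I} {M} b+b⁻≈0 b≤a 0≤a+b I+≤ a²≤M a≡b⊎ =
    [ nonNegative , nonPositive ]′ (total 0# b)
    where
    0≤a : 0# ≤ a
    0≤a = 0≤x+x⇒0≤x (≤-trans 0≤a+b (+-monoʳ-≤ a b≤a))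
    0≤M : 0# ≤ M
    0≤M = ≤-trans (0≤x² a) a²≤M
    M≤2M : M ≤ 2# * M
    M≤2M = begin
      M      ≤⟨ x≤x+y M 0≤M ⟩
      M + M  ≈⟨ solve 1 (λ M → M :+ M := con 2 :* M) refl M ⟩
      2# * M ∎

    nonNegative : 0# ≤ b → ∃[ c ] c ² ≤ 2# * M × I ≤ (a + b) * c
    nonNegative 0≤b = a , ≤-trans a²≤M M≤2M , (begin
      I               ≤⟨ x≤x+y I (0≤q b⁻) ⟩
      I + q b⁻        ≤⟨ I+≤ ⟩
      q a + q b       ≈⟨ +-cong (0≤x⇒q≈x² 0≤a) (0≤x⇒q≈x² 0≤b) ⟩
      a * a + b * b   ≤⟨ +-monoʳ-≤ _ (*-monoʳ-≤ 0≤b b≤a) ⟩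
      a * a + b * a   ≈⟨ solve 2 (λ a b → a :* a :+ b :* a := (a :+ b) :* a) refl a b ⟩
      (a + b) * a     ∎)

    nonPositive : b ≤ 0# → ∃[ c ] c ² ≤ 2# * M × I ≤ (a + b) * c
    nonPositive b≤0 = a + b⁻ , bound a≡b⊎ , +-cancelʳ-≤ (b⁻ ²) (begin
      I + b⁻ ²                       ≈⟨ +-congˡ (0≤x⇒q≈x² (x+y≈0∧x≤0⇒0≤y b+b⁻≈0 b≤0)) ⟨
      I + q b⁻                       ≤⟨ I+≤ ⟩
      q a + q b                      ≈⟨ +-cong (0≤x⇒q≈x² 0≤a) (x≤0⇒q≈0 b≤0) ⟩
      a ² + 0#                       ≈⟨ +-identityʳ _ ⟩
      a ²                            ≈⟨ *-cong t+b⁻≈a t+b⁻≈a ⟨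
      (a + b + b⁻) ²                 ≈⟨ solve 2 (λ t d → (t :+ d) :* (t :+ d)
                                          := t :* (t :+ d :+ d) :+ d :* d) refl (a + b) b⁻ ⟩
      (a + b) * (a + b + b⁻ + b⁻) + b⁻ ² ≈⟨ +-congʳ (*-congˡ (+-congʳ t+b⁻≈a)) ⟩
      (a + b) * (a + b⁻) + b⁻ ²      ∎)
      where
      t+b⁻≈a : a + b + b⁻ ≈ a
      t+b⁻≈a = trans (+-assoc a b b⁻) (trans (+-congˡ b+b⁻≈0) (+-identityʳ a))
      bound : a ≡ b ⊎ a ² + b ² ≤ M → (a + b⁻) ² ≤ 2# * M
      -- When the extrema coincide the energy may contain the square only once, but then `c` is
      -- zero.
      bound (inj₁ ≡.refl) = begin
        (a + b⁻) ²     ≈⟨ *-congʳ b+b⁻≈0 ⟩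
        0# * (a + b⁻)  ≈⟨ zeroˡ _ ⟩
        0#             ≤⟨ *-nonNegative 0≤2 0≤M ⟩
        2# * M         ∎
      -- Parallelogram law: adding (a + b)² turns (a - b)² into 2(a² + b²).
      bound (inj₂ a²+b²≤M) = begin
        (a + b⁻) ²
          ≤⟨ x≤y+x _ (0≤x² (a + b)) ⟩
        (a + b) ² + (a + b⁻) ²
          ≈⟨ solve 3 (λ a b d → (a :+ b) :* (a :+ b) :+ (a :+ d) :* (a :+ d)
               := con 2 :* (a :* (a :+ (b :+ d))) :+ b :* b :+ d :* d) refl a b b⁻ ⟩
        2# * (a * (a + (b + b⁻))) + b ² + b⁻ ²
          ≈⟨ +-cong (+-congʳ (*-congˡ (*-congˡ (trans (+-congˡ b+b⁻≈0) (+-identityʳ a)))))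
               (sym (x+y≈0⇒x²≈y² b+b⁻≈0)) ⟩
        2# * a ² + b ² + b ²
          ≈⟨ solve 2 (λ x y → con 2 :* x :+ y :+ y := con 2 :* (x :+ y)) refl (a ²) (b ²) ⟩
        2# * (a ² + b ²)
          ≤⟨ *-monoʳ-≤ 0≤2 a²+b²≤M ⟩
        2# * M ∎

  -- Summing over all vertices with an indicator lets this sum be exchanged with the sum over edges,
  -- which produces degrees.
  energy : ∀ {n} → Vector Carrier n → Subset n → Carrier
  energy {n} f S = ∑[ x < n ] (f x ² * 𝟙 (x ∈? S))

  module _ {n} {f : Vector Carrier n} {S : Subset n} where
    private
      0≤terms : ∀ x → 0# ≤ f x ² * 𝟙 (x ∈? S)
      0≤terms x = *-nonNegative (0≤x² (f x)) (0≤𝟙 (x ∈? S))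
      term : ∀ {x} → x ∈ S → f x ² * 𝟙 (x ∈? S) ≈ f x ²
      term {x} x∈S = trans (*-congˡ (reflexive (𝟙-yes (x ∈? S) x∈S))) (*-identityʳ _)

    ²≤energy : ∀ {u} → u ∈ S → f u ² ≤ energy f S
    ²≤energy {u} u∈S = ≤-respˡ-≈ (term u∈S) (term≤sum 0≤terms u)

    ²+²≤energy : ∀ {u v} → u ∈ S → v ∈ S → u ≢ v → f u ² + f v ² ≤ energy f S
    ²+²≤energy u∈S v∈S u≢v = ≤-respˡ-≈ (+-cong (term u∈S) (term v∈S)) (terms≤sum 0≤terms u≢v)

    -- The maximiser and the minimiser may be the same vertex, as on a singleton edge; its square
    -- then enters the energy once, hence the first alternative.
    ≡⊎²+²≤energy : ∀ {u v} → u ∈ S → v ∈ S → f u ≡ f v ⊎ f u ² + f v ² ≤ energy f S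
    ≡⊎²+²≤energy {u} {v} u∈S v∈S with u ≟ v
    ... | yes ≡.refl = inj₁ ≡.refl
    ... | no  u≢v    = inj₂ (²+²≤energy u∈S v∈S u≢v)

  energy-opposite : ∀ {n} {f f⁻ : Vector Carrier n} → (∀ x → f x + f⁻ x ≈ 0#) →
                    ∀ S → energy f S ≈ energy f⁻ S
  energy-opposite f+f⁻≈0 S = sum-cong-≋ λ x → *-congʳ (x+y≈0⇒x²≈y² (f+f⁻≈0 x))

  -- The bound for one edge, integrated over all levels.

  module _ {ys} (cake : LayerCake ys) where
    open LayerCake cake

    ∫-level : ∀ {n} (g : Vector Carrier n) {v} → g v ∈ˡ ys →
              ∫ (λ t → 𝟙 (v ∈? level g t)) ≈ g v
    ∫-level g {v} gv∈ = trans (∫-cong λ t _ → antisym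
      (𝟙-mono (v ∈? level g t) (t ≤? g v) (∈-level⁻ g))
      (𝟙-mono (t ≤? g v) (v ∈? level g t) (∈-level⁺ g))) (∫-𝟙 gv∈)

    ∫-contribution : ∀ {n} {f f⁻ : Vector Carrier n} → (∀ x → f x + f⁻ x ≈ 0#) →
      (∀ x → q (f x) ∈ˡ ys) → (∀ x → q (f⁻ x) ∈ˡ ys) →
      ∀ {S u v} → u ∈ S → v ∈ S → (∀ {x} → x ∈ S → f x ≤ f u) → (∀ {x} → x ∈ S → f v ≤ f x) →
      0# ≤ f u + f v →
      ∫ (λ t → contribution (level (q ∘ f) t) (level (q ∘ f⁻) t) S) + q (f⁻ v) ≤ q (f u) + q (f v)
    ∫-contribution {f = f} {f⁻} f+f⁻≈0 qf∈ qf⁻∈ {S} {u} {v} u∈S v∈S f≤fu fv≤f 0≤fu+fv = begin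
      ∫ (λ t → contribution (L t) (R t) S) + q (f⁻ v)
        ≈⟨ +-congˡ (∫-level (q ∘ f⁻) (qf⁻∈ v)) ⟨
      ∫ (λ t → contribution (L t) (R t) S) + ∫ (λ t → 𝟙 (v ∈? R t))
        ≈⟨ ∫-+ (λ t → contribution (L t) (R t) S) (λ t → 𝟙 (v ∈? R t)) ⟨
      ∫ (λ t → contribution (L t) (R t) S + 𝟙 (v ∈? R t))
        -- The hypotheses of `contribution-bound` become inequalities between values of `q`: a
        -- minimiser of `f` maximises `f⁻`, and a nonnegative `f u + f v` says that `f⁻ v ≤ f u`.
        ≤⟨ ∫-mono (λ t 0<t → contribution-bound u∈S v∈S (level-disjoint f+f⁻≈0 0<t)
             (λ x∈S → raise f f (q-mono-≤ (f≤fu x∈S)))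
             (λ x∈S → raise f f (q-mono-≤ (fv≤f x∈S)))
             (λ {x} x∈S → raise f⁻ f⁻ (q-mono-≤ (opposite-antitone (f+f⁻≈0 v) (f+f⁻≈0 x) (fv≤f x∈S))))
             (raise f⁻ f (q-mono-≤ f⁻v≤fu))) ⟩
      ∫ (λ t → 𝟙 (u ∈? L t) + 𝟙 (v ∈? L t))
        ≈⟨ ∫-+ (λ t → 𝟙 (u ∈? L t)) (λ t → 𝟙 (v ∈? L t)) ⟩
      ∫ (λ t → 𝟙 (u ∈? L t)) + ∫ (λ t → 𝟙 (v ∈? L t))
        ≈⟨ +-cong (∫-level (q ∘ f) (qf∈ u)) (∫-level (q ∘ f) (qf∈ v)) ⟩
      q (f u) + q (f v) ∎
      where
      L R : Carrier → Subset _
      L = level (q ∘ f)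
      R = level (q ∘ f⁻)
      f⁻v≤fu : f⁻ v ≤ f u
      f⁻v≤fu = +-cancelʳ-≤ (f v) (≤-respˡ-≈ (trans (sym (f+f⁻≈0 v)) (+-comm _ _)) 0≤fu+fv)
      raise : ∀ g h {t x y} → q (g x) ≤ q (h y) → x ∈ level (q ∘ g) t → y ∈ level (q ∘ h) t
      raise g h qgx≤qhy x∈ = ∈-level⁺ (q ∘ h) (≤-trans (∈-level⁻ (q ∘ g) x∈) qgx≤qhy)

    -- Splits the bound into two factors for Cauchy-Schwarz: the squares of `a` will sum to the
    -- numerator of D, those of `c` to at most twice the norm. Only the square of `a` is prescribed,
    -- so that `a` may be the sum of the extrema or its opposite, according to sign.
    ∫-contribution-factors : ∀ {n} {f f⁻ : Vector Carrier n} → (∀ x → f x + f⁻ x ≈ 0#) →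
      (∀ x → q (f x) ∈ˡ ys) → (∀ x → q (f⁻ x) ∈ˡ ys) → ∀ S (ne : Nonempty S) →
      ∃[ a ] ∃[ c ] a ² ≈ (maxOver f S ne + minOver f S ne) ² × c ² ≤ 2# * energy f S ×
        ∫ (λ t → contribution (level (q ∘ f) t) (level (q ∘ f⁻) t) S) ≤ a * c
    ∫-contribution-factors {f = f} {f⁻} f+f⁻≈0 qf∈ qf⁻∈ S ne
      with maxOver f S ne | maxOver-attained f S ne | minOver f S ne | minOver-attained f S ne
    ... | _ | u , u∈S , ≡.refl , f≤fu | _ | v , v∈S , ≡.refl , fv≤f =
      [ nonNegative , nonPositive ]′ (total 0# (f u + f v))
      where
      L R : Carrier → Subset _
      L = level (q ∘ f)
      R = level (q ∘ f⁻)
      Factors = ∃[ a ] ∃[ c ] a ² ≈ (f u + f v) ² × c ² ≤ 2# * energy f S ×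
        ∫ (λ t → contribution (L t) (R t) S) ≤ a * c

      nonNegative : 0# ≤ f u + f v → Factors
      nonNegative 0≤fu+fv = let c , c²≤ , I≤ = edge-algebra (f+f⁻≈0 v) (fv≤f u∈S) 0≤fu+fv
                                  (∫-contribution f+f⁻≈0 qf∈ qf⁻∈ u∈S v∈S f≤fu fv≤f 0≤fu+fv)
                                  (²≤energy u∈S) (≡⊎²+²≤energy u∈S v∈S)
        in f u + f v , c , refl , c²≤ , I≤

      f⁻+f≈0 : ∀ x → f⁻ x + f x ≈ 0#
      f⁻+f≈0 x = trans (+-comm _ _) (f+f⁻≈0 x)

      nonPositive : f u + f v ≤ 0# → Factors
      -- The previous case applied to `f⁻`, which is maximal at `v` and minimal at `u`; swapping L
      -- and R and comparing energies returns to `f`.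
      nonPositive fu+fv≤0 =
        let 0≤f⁻v+f⁻u = x+y≈0∧x≤0⇒0≤y opposite fu+fv≤0
            antitone = λ {x} {y} → opposite-antitone (f+f⁻≈0 x) (f+f⁻≈0 y)
            c , c²≤ , I≤ = edge-algebra (f⁻+f≈0 u) (antitone (fv≤f u∈S)) 0≤f⁻v+f⁻u
              (∫-contribution f⁻+f≈0 qf⁻∈ qf∈ v∈S u∈S
                (antitone ∘ fv≤f) (antitone ∘ f≤fu) 0≤f⁻v+f⁻u)
              (²≤energy v∈S) (≡⊎²+²≤energy v∈S u∈S)
        in f⁻ v + f⁻ u , c , sym (x+y≈0⇒x²≈y² opposite) ,
           ≤-respʳ-≈ (*-congˡ (sym (energy-opposite f+f⁻≈0 S))) c²≤ ,
           ≤-respˡ-≈ (∫-cong λ t _ → contribution-swap (R t) (L t) S) I≤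
        where
        opposite : f u + f v + (f⁻ v + f⁻ u) ≈ 0#
        opposite = begin-equality
          f u + f v + (f⁻ v + f⁻ u)   ≈⟨ solve 4 (λ a b c d → a :+ b :+ (c :+ d) := (a :+ d) :+ (b :+ c))
                                           refl (f u) (f v) (f⁻ v) (f⁻ u) ⟩
          f u + f⁻ u + (f v + f⁻ v)   ≈⟨ +-cong (f+f⁻≈0 u) (f+f⁻≈0 v) ⟩
          0# + 0#                     ≈⟨ +-identityʳ 0# ⟩
          0#                          ∎

  -- Summation over the hypergraph and the choice of a level.

  module _ {n} (H : Hypergraph n) where
    open Hypergraph H

    0≤deg : ∀ v → 0# ≤ deg H v
    0≤deg v = sum-nonNegative λ e → *-nonNegative (proj₁ (w-positive e)) (0≤𝟙 (v ∈? edge e))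

    0≤vol : ∀ S → 0# ≤ vol H S
    0≤vol S = sum-nonNegative λ v → *-nonNegative (0≤deg v) (0≤𝟙 (v ∈? S))

    -- After exchanging the sums, the square at a vertex is weighted by all edges containing it,
    -- that is, by its degree.
    ∑-energy : ∀ f → ∑[ e < ∣E∣ ] (w e * energy f (edge e)) ≈ ∥_∥²-deg H f
    ∑-energy f = begin-equality
      ∑[ e < ∣E∣ ] (w e * energy f (edge e))
        ≈⟨ sum-cong-≋ (λ e → *-distribˡ-sum (w e) (λ v → f v ² * 𝟙 (v ∈? edge e))) ⟩
      ∑[ e < ∣E∣ ] ∑[ v < n ] (w e * (f v ² * 𝟙 (v ∈? edge e)))
        ≈⟨ ∑-comm (λ e v → w e * (f v ² * 𝟙 (v ∈? edge e))) ⟩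
      ∑[ v < n ] ∑[ e < ∣E∣ ] (w e * (f v ² * 𝟙 (v ∈? edge e)))
        ≈⟨ sum-cong-≋ (λ v → sum-cong-≋ λ e →
             solve 3 (λ w x i → w :* (x :* i) := x :* (w :* i)) refl (w e) (f v ²) (𝟙 (v ∈? edge e))) ⟩
      ∑[ v < n ] ∑[ e < ∣E∣ ] (f v ² * (w e * 𝟙 (v ∈? edge e)))
        ≈⟨ sum-cong-≋ (λ v → *-distribˡ-sum (f v ²) (λ e → w e * 𝟙 (v ∈? edge e))) ⟨
      ∑[ v < n ] (f v ² * deg H v)
        ≈⟨ sum-cong-≋ (λ v → *-comm (f v ²) (deg H v)) ⟩
      ∑[ v < n ] (deg H v * f v ²) ∎

    numerator : (L R : Subset n) → Carrier
    numerator L R = 2# * cut₁ H L (∁ L) + 2# * cut₁ H R (∁ R)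
      + cut H L (∁ (L ∪ R)) R + cut H R (∁ (L ∪ R)) L

    numerator-contributions : ∀ L R →
      numerator L R ≈ ∑[ e < ∣E∣ ] (w e * contribution L R (edge e))
    numerator-contributions L R = sym (begin-equality
      ∑[ e < ∣E∣ ] (w e * contribution L R (edge e))
        ≈⟨ sum-cong-≋ (λ e → solve 5 (λ w a b c d →
             w :* (con 2 :* a :+ con 2 :* b :+ c :+ d)
               := con 2 :* (w :* a) :+ con 2 :* (w :* b) :+ w :* c :+ w :* d)
             refl (w e) (edgeCut (edge e) L L (∁ L)) (edgeCut (edge e) R R (∁ R))
             (edgeCut (edge e) L (∁ (L ∪ R)) R) (edgeCut (edge e) R (∁ (L ∪ R)) L)) ⟩
      ∑[ e < ∣E∣ ] (2# * inL e + 2# * inR e + outL e + outR e)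
        ≈⟨ ∑-distrib-+ _ outR ⟩
      ∑[ e < ∣E∣ ] (2# * inL e + 2# * inR e + outL e) + sum outR
        ≈⟨ +-congʳ (∑-distrib-+ _ outL) ⟩
      ∑[ e < ∣E∣ ] (2# * inL e + 2# * inR e) + sum outL + sum outR
        ≈⟨ +-congʳ (+-congʳ (∑-distrib-+ (λ e → 2# * inL e) (λ e → 2# * inR e))) ⟩
      ∑[ e < ∣E∣ ] (2# * inL e) + ∑[ e < ∣E∣ ] (2# * inR e) + sum outL + sum outR
        ≈⟨ +-congʳ (+-congʳ (+-cong (*-distribˡ-sum 2# inL) (*-distribˡ-sum 2# inR))) ⟨
      numerator L R ∎)
      where
      inL inR outL outR : Vector Carrier ∣E∣
      inL e = w e * edgeCut (edge e) L L (∁ L)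
      inR e = w e * edgeCut (edge e) R R (∁ R)
      outL e = w e * edgeCut (edge e) L (∁ (L ∪ R)) R
      outR e = w e * edgeCut (edge e) R (∁ (L ∪ R)) L

    0≤numerator : ∀ L R → 0# ≤ numerator L R
    0≤numerator L R = ≤-respʳ-≈ (sym (numerator-contributions L R)) (sum-nonNegative λ e →
      *-nonNegative (proj₁ (w-positive e)) (0≤contribution L R (edge e)))

    -- `θ` is the root of twice `γ`, given through its sign and square. The integrated numerator is
    -- at most `θ` times the integrated volume, so some atom of the measure gives a level with ratio
    -- at most `θ`.
    rounding : ∀ {f θ γ} (0<∥f∥² : 0# < ∥_∥²-deg H f) → 0# ≤ θ → θ ² ≈ 2# * γ →
      γ ≈ D H f 0<∥f∥² →
      ∃[ L ] ∃[ R ] Empty (L ∩ R) × Σ (0# < vol H (L ∪ R)) λ 0<vol → β H L R 0<vol ≤ θ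
    rounding {f} {θ} {γ} 0<N 0≤θ θ²≈2γ γ≈D =
      let j , 0<vol , num≤θvol = exists-below-average p-positive
            (λ j → 0≤numerator (L (s j)) (R (s j))) (λ j → 0≤vol (L (s j) ∪ R (s j)))
            (<-respʳ-≈ (sym ∫vol≈N) 0<N)
            (≤-trans ∫numerator≤θN (≤-reflexive (*-congˡ (sym ∫vol≈N))))
      in L (s j) , R (s j) , level-disjoint f+f⁻≈0 (s-positive j) , 0<vol , /-≤ 0<vol num≤θvol
      where
      f⁻ : Vector Carrier n
      f⁻ v = - f v
      f+f⁻≈0 : ∀ v → f v + f⁻ v ≈ 0#
      f+f⁻≈0 v = -‿inverseʳ (f v)
      -- All thresholds at which a vertex leaves L or R, so that the finite measure is exact for
      -- every integral below.
      ys = map (q ∘ f) (allFin n) ++ map (q ∘ f⁻) (allFin n)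
      qf∈ : ∀ v → q (f v) ∈ˡ ys
      qf∈ v = ∈-++⁺ˡ (∈-map⁺ (q ∘ f) (∈-allFin v))
      qf⁻∈ : ∀ v → q (f⁻ v) ∈ˡ ys
      qf⁻∈ v = ∈-++⁺ʳ _ (∈-map⁺ (q ∘ f⁻) (∈-allFin v))
      cake : LayerCake ys
      cake = layerCake ys (AllP.++⁺ (AllP.map⁺ (All.universal (0≤q ∘ f) (allFin n)))
                                (AllP.map⁺ (All.universal (0≤q ∘ f⁻) (allFin n))))
      open LayerCake cake
      L R : Carrier → Subset n
      L = level (q ∘ f)
      R = level (q ∘ f⁻)
      N = ∥_∥²-deg H f

      ∫vol≈N : ∫ (λ t → vol H (L t ∪ R t)) ≈ N
      ∫vol≈N = begin-equality
        ∫ (λ t → vol H (L t ∪ R t))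
          ≈⟨ ∫-sum (deg H) (λ v t → 𝟙 (v ∈? L t ∪ R t)) ⟩
        ∑[ v < n ] (deg H v * ∫ (λ t → 𝟙 (v ∈? L t ∪ R t)))
          ≈⟨ sum-cong-≋ (λ v → *-congˡ (begin-equality
               ∫ (λ t → 𝟙 (v ∈? L t ∪ R t))
                 ≈⟨ ∫-cong (λ t 0<t → 𝟙-∪ (level-disjoint f+f⁻≈0 0<t) v) ⟩
               ∫ (λ t → 𝟙 (v ∈? L t) + 𝟙 (v ∈? R t))
                 ≈⟨ ∫-+ (λ t → 𝟙 (v ∈? L t)) (λ t → 𝟙 (v ∈? R t)) ⟩
               ∫ (λ t → 𝟙 (v ∈? L t)) + ∫ (λ t → 𝟙 (v ∈? R t))
                 ≈⟨ +-cong (∫-level cake (q ∘ f) (qf∈ v)) (∫-level cake (q ∘ f⁻) (qf⁻∈ v)) ⟩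
               q (f v) + q (f⁻ v)
                 ≈⟨ q-opposite (f+f⁻≈0 v) ⟩
               f v ² ∎)) ⟩
        N ∎

      factors = λ e → ∫-contribution-factors cake f+f⁻≈0 qf∈ qf⁻∈ (edge e) (edge-nonempty e)
      a c : Vector Carrier ∣E∣
      a e = proj₁ (factors e)
      c e = proj₁ (proj₂ (factors e))

      ∑a²≈γN : ∑[ e < ∣E∣ ] (w e * a e ²) ≈ γ * N
      -- The sum is the numerator of D(f), recovered from the quotient `γ` by multiplying with `N`.
      ∑a²≈γN = trans (sum-cong-≋ λ e → *-congˡ (proj₁ (proj₂ (proj₂ (factors e)))))
        (trans (sym (/-cancel _ 0<N)) (*-congʳ (sym γ≈D)))

      ∑c²≤2N : ∑[ e < ∣E∣ ] (w e * c e ²) ≤ 2# * N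
      ∑c²≤2N = begin
        ∑[ e < ∣E∣ ] (w e * c e ²)
          ≤⟨ sum-mono-≤ (λ e → let _ , _ , _ , c²≤ , _ = factors e in
               *-monoʳ-≤ (proj₁ (w-positive e)) c²≤) ⟩
        ∑[ e < ∣E∣ ] (w e * (2# * energy f (edge e)))
          ≈⟨ sum-cong-≋ (λ e → solve 2 (λ w x → w :* (con 2 :* x) := con 2 :* (w :* x))
               refl (w e) (energy f (edge e))) ⟩
        ∑[ e < ∣E∣ ] (2# * (w e * energy f (edge e)))
          ≈⟨ *-distribˡ-sum 2# (λ e → w e * energy f (edge e)) ⟨
        2# * ∑[ e < ∣E∣ ] (w e * energy f (edge e))
          ≈⟨ *-congˡ (∑-energy f) ⟩
        2# * N ∎

      ∑ac≤θN : ∑[ e < ∣E∣ ] (w e * (a e * c e)) ≤ θ * N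
      -- Cauchy-Schwarz bounds the square by γN · 2N, which is (θN)².
      ∑ac≤θN = ²-cancel-≤ (*-nonNegative 0≤θ (proj₁ 0<N)) (begin
        (∑[ e < ∣E∣ ] (w e * (a e * c e))) ²
          ≤⟨ cauchy-schwarz (proj₁ ∘ w-positive) ⟩
        (∑[ e < ∣E∣ ] (w e * a e ²)) * (∑[ e < ∣E∣ ] (w e * c e ²))
          ≤⟨ *-monoʳ-≤ (sum-nonNegative λ e → *-nonNegative (proj₁ (w-positive e)) (0≤x² (a e)))
               ∑c²≤2N ⟩
        (∑[ e < ∣E∣ ] (w e * a e ²)) * (2# * N)
          ≈⟨ *-congʳ ∑a²≈γN ⟩
        γ * N * (2# * N)
          ≈⟨ solve 2 (λ γ N → γ :* N :* (con 2 :* N) := con 2 :* γ :* (N :* N)) refl γ N ⟩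
        2# * γ * N ²
          ≈⟨ *-congʳ θ²≈2γ ⟨
        θ ² * N ²
          ≈⟨ solve 2 (λ θ N → θ :* θ :* (N :* N) := θ :* N :* (θ :* N)) refl θ N ⟩
        (θ * N) ² ∎)

      ∫numerator≤θN : ∫ (λ t → numerator (L t) (R t)) ≤ θ * N
      ∫numerator≤θN = begin
        ∫ (λ t → numerator (L t) (R t))
          ≈⟨ ∫-cong (λ t _ → numerator-contributions (L t) (R t)) ⟩
        ∫ (λ t → ∑[ e < ∣E∣ ] (w e * contribution (L t) (R t) (edge e)))
          ≈⟨ ∫-sum w (λ e t → contribution (L t) (R t) (edge e)) ⟩
        ∑[ e < ∣E∣ ] (w e * ∫ (λ t → contribution (L t) (R t) (edge e)))
          ≤⟨ sum-mono-≤ (λ e → let _ , _ , _ , _ , ∫≤ac = factors e in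
               *-monoʳ-≤ (proj₁ (w-positive e)) ∫≤ac) ⟩
        ∑[ e < ∣E∣ ] (w e * (a e * c e))
          ≤⟨ ∑ac≤θN ⟩
        θ * N ∎

    0≤D : ∀ f 0<∥f∥² → 0# ≤ D H f 0<∥f∥²
    0≤D f 0<∥f∥² = *-cancelʳ-≤ 0<∥f∥² (begin
      0# * ∥_∥²-deg H f             ≈⟨ zeroˡ _ ⟩
      0#                            ≤⟨ sum-nonNegative (λ e → *-nonNegative (proj₁ (w-positive e)) (0≤x² _)) ⟩
      _                             ≈⟨ /-cancel _ 0<∥f∥² ⟨
      D H f 0<∥f∥² * ∥_∥²-deg H f   ∎)

-- Rounding a minimiser of D.

theorem4 : ∀ {ℓ} (ℝ : CompleteOrderedField ℓ) →
    let open CompleteOrderedField ℝ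
        open HypergraphTheory ℝ in
    ∀ {n : ℕ} (H : Hypergraph n) → 0 <ᴺ Hypergraph.∣E∣ H →
    ∀ γ₁ → IsMinimum (IsValueOfD H) γ₁ →
    ∃[ L ] ∃[ R ] Empty (L ∩ R) ×
      Σ (0# < vol H (L ∪ R)) λ 0<vol → β H L R 0<vol ≤ √ (2# * γ₁)
theorem4 ℝ H _ γ₁ ((f , 0<∥f∥² , γ₁≈D) , _) =
  rounding H 0<∥f∥² (0≤√ (2# * γ₁)) (√-square 0≤2γ₁) γ₁≈D
  where
  open CompleteOrderedField ℝ
  open OrderedField ℝ
  open Rounding ℝ
  open SquareRoot ℝ using (0≤√; √-square)
  -- `√` sends negative arguments to the root of zero, so its square gives back the argument only
  -- once that is known to be nonnegative.
  0≤2γ₁ : 0# ≤ 2# * γ₁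
  0≤2γ₁ = *-nonNegative 0≤2 (≤-respʳ-≈ (sym γ₁≈D) (0≤D H f 0<∥f∥²))
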